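{- \begin{enumerate} \item There exists a linear threshold function $f:\{ -1,1\}^n\to\{ -1,1\}$ and an absolute constant $c>0$ such that $\mathsf{PP}(f\circ\mathsf{XOR})\ge cn$. \item $\mathsf{PP}(\mathsf{GHR})\ge\Omega(\sqrt n)$, where $n$ is the number of input variables of the universal threshold function underlying $\mathsf{GHR}$. \end{enumerate}
   Context: A linear threshold function is $f(x)=\mathrm{sgn}(\sum_i w_ix_i)$ for real (integer) weights with the sum never zero. $(f\circ\mathsf{XOR})(x,y)=f(x_1y_1,\dots,x_ny_n)$ with Alice holding $x$ and Bob $y$. The universal threshold function $U_{l,k}:(\{ -1,1\}^k)^l\to\{ -1,1\}$ is $U_{l,k}(x)=\mathrm{sgn}\big(\sum_{i=1}^k\sum_{j=1}^l 2^ix_{i,j}+\tfrac12\big)$; it is universal in that every linear threshold function on $N$ variables is a subfunction of $U_{l,k}$ for some $l,k\in O(N\log N)$. The $\mathsf{GHR}$ function is $\mathsf{UTHR}\circ\mathsf{XOR}$, i.e. $U_{l,k}\circ\mathsf{XOR}$ (e.g. $U_{4m,m}\circ\mathsf{XOR}$), with $n=lk$ inner variables. For a two-party $G$, $R_\epsilon(G)$ is the minimum cost of a private-coin protocol correct with probability $\ge1/2+\epsilon$ on every input, and $\mathsf{PP}(G)=\min_{\epsilon>0}(R_\epsilon(G)+\log(1/\epsilon))$.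
   Formalization: The message probabilities of the private-coin protocols and the advantage ε are taken rational rather than real; GHR is taken as the family U_{4m,m}∘XOR with n = 4m². -}

module Defs where

open import Data.Bool using (Bool; true; false; _xor_; if_then_else_)
open import Data.Nat as ℕ using (ℕ; zero; suc)
open import Data.Fin using (Fin; zero; suc; toℕ)
open import Data.Integer as ℤ using (ℤ; +_; -[1+_])
open import Data.Rational as ℚ using (ℚ; 0ℚ; 1ℚ; ½; _≤_; _<_; _+_; _-_; _*_)
open import Data.Product using (Σ; _×_; _,_)
open import Relation.Binary.PropositionalEquality using (_≡_; _≢_)
open import Relation.Nullary.Decidable using (⌊_⌋)

-- Boolean encoding of {-1,1}: false ↦ +1, true ↦ -1.
-- Under this encoding the product x·y of two ±1 values is  x xor y.
toℤ± : Bool → ℤ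
toℤ± false = + 1
toℤ± true  = -[1+ 0 ]

-- sign of a (nonzero) integer, in the same encoding: negative ↦ true (= -1)
sgn : ℤ → Bool
sgn (+ _)     = false
sgn -[1+ _ ]  = true

∑ : (n : ℕ) → (Fin n → ℤ) → ℤ
∑ zero    g = + 0
∑ (suc n) g = g zero ℤ.+ ∑ n (λ i → g (suc i))

IsLTF : (n : ℕ) → ((Fin n → Bool) → Bool) → Set
IsLTF n f = Σ (Fin n → ℤ) λ w →
  ((x : Fin n → Bool) → ∑ n (λ i → w i ℤ.* toℤ± (x i)) ≢ + 0) ×
  ((x : Fin n → Bool) → f x ≡ sgn (∑ n (λ i → w i ℤ.* toℤ± (x i))))

_∘XOR : ∀ {n} → ((Fin n → Bool) → Bool) → (Fin n → Bool) → (Fin n → Bool) → Bool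
(f ∘XOR) x y = f (λ i → x i xor y i)

_^ℚ_ : ℚ → ℕ → ℚ
q ^ℚ zero  = 1ℚ
q ^ℚ suc n = q * (q ^ℚ n)

-- Universal threshold function U_{l,k}, input x_{i,j} with i ∈ [k], j ∈ [l]
-- (index i : Fin k stands for i+1 ∈ {1..k}):
--   U_{l,k}(x) = sgn( ∑_{i=1}^k ∑_{j=1}^l 2^i x_{i,j} + 1/2 ).
Ulk : (l k : ℕ) → (Fin k → Fin l → Bool) → Bool
Ulk l k x = ⌊ ℚ._<?_ (ℚ._/_ (∑ k (λ i → ∑ l (λ j → (+ (2 ℕ.^ suc (toℕ i))) ℤ.* toℤ± (x i j)))) 1 + ½) 0ℚ ⌋

GHR : (l k : ℕ) → (Fin k → Fin l → Bool) → (Fin k → Fin l → Bool) → Bool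
GHR l k x y = Ulk l k (λ i j → x i j xor y i j)

-- Private-coin two-party protocols (protocol trees).  At an Alice node, Alice
-- sends bit 1 with probability p x (depending only on her input x and the node)
-- and the protocol continues in the corresponding subtree; likewise for Bob.
-- Leaves output a bit.  Probabilities are rationals in [0,1].
data Protocol (X Y : Set) : Set where
  leaf  : Bool → Protocol X Y
  alice : (p : X → ℚ) → (∀ x → (0ℚ ≤ p x) × (p x ≤ 1ℚ)) →
          (on0 on1 : Protocol X Y) → Protocol X Y
  bob   : (p : Y → ℚ) → (∀ y → (0ℚ ≤ p y) × (p y ≤ 1ℚ)) →
          (on0 on1 : Protocol X Y) → Protocol X Y

cost : ∀ {X Y} → Protocol X Y → ℕ
cost (leaf _)          = 0
cost (alice _ _ P₀ P₁) = suc (cost P₀ ℕ.⊔ cost P₁)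
cost (bob _ _ P₀ P₁)   = suc (cost P₀ ℕ.⊔ cost P₁)

probOut : ∀ {X Y} → Protocol X Y → X → Y → Bool → ℚ
probOut (leaf o) x y b = if ⌊ o Data.Bool.≟ b ⌋ then 1ℚ else 0ℚ
probOut (alice p _ P₀ P₁) x y b =
  (p x * probOut P₁ x y b) + ((1ℚ - p x) * probOut P₀ x y b)
probOut (bob p _ P₀ P₁) x y b =
  (p y * probOut P₁ x y b) + ((1ℚ - p y) * probOut P₀ x y b)

Computes : ∀ {X Y} → Protocol X Y → (X → Y → Bool) → ℚ → Set
Computes {X} {Y} P G ε = (x : X) (y : Y) → ½ + ε ≤ probOut P x y (G x y)

-- "PP(G) ≥ (1/q)·N", i.e. for every ε > 0 and every protocol P computing G
-- with advantage ε:  cost P + log₂(1/ε) ≥ N/q, written without logarithms as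
--   ε^q · 2^N ≤ 2^(q · cost P).
PP≥ : ∀ {X Y} → (X → Y → Bool) → (q N : ℕ) → Set
PP≥ {X} {Y} G q N = (P : Protocol X Y) (ε : ℚ) → 0ℚ < ε → Computes P G ε →
  (ε ^ℚ q) * ℚ._/_ (+ (2 ℕ.^ N)) 1 ≤ ℚ._/_ (+ (2 ℕ.^ (q ℕ.* cost P))) 1

-- Idea.  For inputs u, v ∈ {0,1}ⁿ let s = Σ wᵢuᵢvᵢ and ask whether s < θ.  The signed measure that is +1
-- where s = θ and -1 where s = θ - 1 has the sign of this threshold function, and by two applications of
-- Cauchy–Schwarz its correlation with any product function a(u)b(v), hence with any cheap protocol, is
-- controlled by the sum over u, u′, v, v′ of the product of the measure at the four pairs.  Average that
-- sum over random weights w ∈ [M]ⁿ.  Typically each of the four dot products has a coordinate that it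
-- alone sees, so the values of the four sums are spread over about M⁴ possibilities, and one further
-- such coordinate makes the ±1 pattern telescope, which gains another factor M.  Hence the correlation is
-- exponentially small for M = 2^(n/128), and some w and θ are good.  Since (1 + x)(1 + y) = 4uv for
-- x = 2u - 1 and y = 2v - 1, the function is a restriction of an LTF composed with XOR on 3n + 1
-- variables, and, writing the weights in binary, of GHR with 4(n + 1) variables per level.

{-# OPTIONS --safe #-}
module Submission where

open import Defs

-- The obstacle is normalisation. For one threshold the measure lives only on pairs whose dot
-- product is `θ` or `θ - 1`, which on average over `θ` is about a 1/`R` share of all pairs, where
-- `R` > n`M` is the range of thresholds. Comparing the box sum with the fourth power of this mass
-- costs `R`^4, so the gain `M`^4 from four separately seen coordinates is lost again, and a
-- nontrivial bound must come from the fifth factor `M`. That factor exists because the measure is a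
-- discrete derivative: a sum over consecutive weights collapses to two boundary terms. What is left
-- is `M`^5 / `R`^4, about `M` / n^4. The size of `M` is limited from the other side by the
-- quadruples in which some required coordinate pattern is missing. Nothing is gained on them, so
-- their share, bounded by (31/32)^n, has to stay below `M`^-5. This permits `M` exponential in n,
-- but only with a small rate.

module Analysis where

  open import Data.Bool using (Bool; true; false; _∧_; if_then_else_)
  open import Data.Nat as ℕ using (ℕ; zero; suc)
  import Data.Nat.Properties as ℕₚ
  open import Data.Nat.Coprimality as Coprime using (1-coprimeTo)
  open import Data.Nat.Tactic.RingSolver using (solve-∀)
  import Data.Integer as ℤ
  import Data.Integer.Properties as ℤₚ
  open import Data.Rational using (ℚ; mkℚ; 0ℚ; 1ℚ; ½; _≤_; _<_; _+_; _-_; _*_; -_; _/_; ∣_∣; nonNegative; positive)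
  open import Data.Rational.Properties
  open import Data.Rational.Solver using (module +-*-Solver)
  import Data.Rational.Unnormalised as ℚᵘ
  import Data.Rational.Unnormalised.Properties as ℚᵘₚ
  open import Data.List as List using (List; []; _∷_; length; _++_; concatMap; allFin)
  import Data.List.Properties as Listₚ
  open import Data.Vec as Vec using (Vec; []; _∷_)
  open import Data.Fin using (Fin; zero; suc; toℕ)
  import Data.Fin.Properties as Finₚ
  open import Data.Product using (_×_; _,_; proj₁; proj₂; ∃; ∃₂; Σ-syntax)
  open import Data.Sum using (_⊎_; inj₁; inj₂)
  open import Function using (_∘_; id)
  open import Relation.Binary.PropositionalEquality
  open import Algebra.Properties.CommutativeSemigroup ℕₚ.+-commutativeSemigroup using (x∙yz≈y∙xz)
  open +-*-Solver

  -- Inequalities and finite sums over the rationals.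

  variable
    A B : Set
    x y z p q : ℚ

  0≤1 : 0ℚ ≤ 1ℚ
  0≤1 = ≤ᵇ⇒≤ _

  *-nonNeg : 0ℚ ≤ x → 0ℚ ≤ y → 0ℚ ≤ x * y
  *-nonNeg {x} {y} 0≤x 0≤y =
    subst (_≤ x * y) (*-zeroʳ x) (*-monoˡ-≤-nonNeg x {{nonNegative 0≤x}} 0≤y)

  +-nonNeg : 0ℚ ≤ x → 0ℚ ≤ y → 0ℚ ≤ x + y
  +-nonNeg = +-mono-≤

  *-mono-≤-nonNeg : 0ℚ ≤ x → x ≤ y → 0ℚ ≤ p → p ≤ q → x * p ≤ y * q
  *-mono-≤-nonNeg {x} {y} {p} {q} 0≤x x≤y 0≤p p≤q = ≤-trans
    (*-monoʳ-≤-nonNeg p {{nonNegative 0≤p}} x≤y)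
    (*-monoˡ-≤-nonNeg y {{nonNegative (≤-trans 0≤x x≤y)}} p≤q)

  *-monoˡ-≤′ : 0ℚ ≤ z → x ≤ y → z * x ≤ z * y
  *-monoˡ-≤′ {z} 0≤z = *-monoˡ-≤-nonNeg z {{nonNegative 0≤z}}

  *-monoʳ-≤′ : 0ℚ ≤ z → x ≤ y → x * z ≤ y * z
  *-monoʳ-≤′ {z} 0≤z = *-monoʳ-≤-nonNeg z {{nonNegative 0≤z}}

  0≤x² : ∀ x → 0ℚ ≤ x * x
  0≤x² x with ≤-total 0ℚ x
  ... | inj₁ 0≤x = *-nonNeg 0≤x 0≤x
  ... | inj₂ x≤0 = subst (0ℚ ≤_) (solve 1 (λ a → (:- a) :* (:- a) := a :* a) refl x)
                     (*-nonNeg 0≤-x 0≤-x)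
    where 0≤-x = neg-antimono-≤ x≤0

  0≤y-x⇒x≤y : 0ℚ ≤ y - x → x ≤ y
  0≤y-x⇒x≤y {y} {x} h = subst₂ _≤_ (+-identityˡ x)
    (solve 2 (λ a b → (a :- b) :+ b := a) refl y x) (+-monoˡ-≤ x h)

  x≤y⇒0≤y-x : x ≤ y → 0ℚ ≤ y - x
  x≤y⇒0≤y-x {x} {y} h = subst (_≤ y - x) (+-inverseʳ x) (+-monoˡ-≤ (- x) h)

  2xy≤x²+y² : ∀ x y → (x * y) + (x * y) ≤ x * x + y * y
  2xy≤x²+y² x y = 0≤y-x⇒x≤y (subst (0ℚ ≤_)
    (solve 2 (λ a b → (a :- b) :* (a :- b) := (a :* a :+ b :* b) :- (a :* b :+ a :* b)) refl x y)
    (0≤x² (x - y)))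

  x≤∣x∣ : ∀ x → x ≤ ∣ x ∣
  x≤∣x∣ x with ≤-total 0ℚ x
  ... | inj₁ 0≤x = ≤-reflexive (sym (0≤p⇒∣p∣≡p 0≤x))
  ... | inj₂ x≤0 = ≤-trans x≤0 (0≤∣p∣ x)

  sq : ℚ → ℚ
  sq x = x * x

  sq-mono : 0ℚ ≤ x → x ≤ y → sq x ≤ sq y
  sq-mono 0≤x x≤y = *-mono-≤-nonNeg 0≤x x≤y 0≤x x≤y

  sq-+ : ∀ x y → sq (x + y) ≤ (sq x + sq y) + (sq x + sq y)
  sq-+ x y = subst (_≤ (sq x + sq y) + (sq x + sq y))
    (solve 2 (λ a b → (a :* b :+ a :* b) :+ (a :* a :+ b :* b) := (a :+ b) :* (a :+ b)) refl x y)
    (+-monoˡ-≤ (sq x + sq y) (2xy≤x²+y² x y))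

  sq-* : ∀ x y → sq (x * y) ≡ sq x * sq y
  sq-* = solve 2 (λ a b → (a :* b) :* (a :* b) := (a :* a) :* (b :* b)) refl

  -- Built by the constructor because `n / 1` normalises through a gcd that is stuck for variable
  -- `n`; `+n/1≡ιn` returns to the form used in `PP≥`.
  ι : ℕ → ℚ
  ι n = mkℚ (ℤ.+ n) 0 (Coprime.sym (1-coprimeTo n))

  +n/1≡ιn : ∀ n → (ℤ.+ n) / 1 ≡ ι n
  +n/1≡ιn n = normalize-coprime (Coprime.sym (1-coprimeTo n))

  ι-suc : ∀ n → ι (suc n) ≡ 1ℚ + ι n
  ι-suc n = toℚᵘ-injective (ℚᵘₚ.≃-trans
    (ℚᵘ.*≡* (cong (ℤ._* (ℤ.+ 1)) (cong (ℤ._+_ (ℤ.+ 1)) (sym (ℤₚ.*-identityʳ (ℤ.+ n))))))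
    (ℚᵘₚ.≃-sym (toℚᵘ-homo-+ 1ℚ (ι n))))

  0≤ι : ∀ n → 0ℚ ≤ ι n
  0≤ι n = nonNegative⁻¹ (ι n)

  ι-+ : ∀ m n → ι (m ℕ.+ n) ≡ ι m + ι n
  ι-+ zero    n = sym (+-identityˡ (ι n))
  ι-+ (suc m) n = trans (ι-suc (m ℕ.+ n)) (trans (cong (1ℚ +_) (ι-+ m n))
    (trans (sym (+-assoc 1ℚ (ι m) (ι n))) (cong (_+ ι n) (sym (ι-suc m)))))

  ι-* : ∀ m n → ι (m ℕ.* n) ≡ ι m * ι n
  ι-* zero    n = sym (*-zeroˡ (ι n))
  ι-* (suc m) n = trans (ι-+ n (m ℕ.* n)) (trans (cong (ι n +_) (ι-* m n))
    (trans (solve 2 (λ a b → b :+ a :* b := (con 1ℚ :+ a) :* b) refl (ι m) (ι n)) (cong (_* ι n) (sym (ι-suc m)))))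

  ι-mono : ∀ {m n} → m ℕ.≤ n → ι m ≤ ι n
  ι-mono {m} {n} m≤n = subst₂ _≤_ (+-identityʳ (ι m)) (trans (sym (ι-+ m (n ℕ.∸ m))) (cong ι (ℕₚ.m+[n∸m]≡n m≤n)))
    (+-monoʳ-≤ (ι m) (0≤ι (n ℕ.∸ m)))

  ι-pos : ∀ n .{{_ : ℕ.NonZero n}} → 0ℚ < ι n
  ι-pos (suc n) = positive⁻¹ (ι (suc n))

  ∑ℚ : List A → (A → ℚ) → ℚ
  ∑ℚ []       f = 0ℚ
  ∑ℚ (x ∷ xs) f = f x + ∑ℚ xs f

  infixr 5 ∑ℚ
  syntax ∑ℚ xs (λ x → e) = ∑[ x ∈ xs ] e

  ∑-cong : ∀ (xs : List A) {f g : A → ℚ} → (∀ x → f x ≡ g x) → ∑ℚ xs f ≡ ∑ℚ xs g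
  ∑-cong []       h = refl
  ∑-cong (x ∷ xs) h = cong₂ _+_ (h x) (∑-cong xs h)

  ∑-mono : ∀ (xs : List A) {f g : A → ℚ} → (∀ x → f x ≤ g x) → ∑ℚ xs f ≤ ∑ℚ xs g
  ∑-mono []       h = ≤-refl
  ∑-mono (x ∷ xs) h = +-mono-≤ (h x) (∑-mono xs h)

  ∑-nonNeg : ∀ (xs : List A) {f : A → ℚ} → (∀ x → 0ℚ ≤ f x) → 0ℚ ≤ ∑ℚ xs f
  ∑-nonNeg []       h = ≤-refl
  ∑-nonNeg (x ∷ xs) h = +-nonNeg (h x) (∑-nonNeg xs h)

  ∑-distrib-+ : ∀ (xs : List A) (f g : A → ℚ) → ∑[ x ∈ xs ] (f x + g x) ≡ ∑ℚ xs f + ∑ℚ xs g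
  ∑-distrib-+ []       f g = refl
  ∑-distrib-+ (x ∷ xs) f g = trans (cong (λ s → f x + g x + s) (∑-distrib-+ xs f g))
    (solve 4 (λ a b c d → a :+ b :+ (c :+ d) := (a :+ c) :+ (b :+ d)) refl (f x) (g x) (∑ℚ xs f) (∑ℚ xs g))

  ∑-*ˡ : ∀ (xs : List A) c (f : A → ℚ) → ∑[ x ∈ xs ] (c * f x) ≡ c * ∑ℚ xs f
  ∑-*ˡ []       c f = sym (*-zeroʳ c)
  ∑-*ˡ (x ∷ xs) c f = trans (cong (c * f x +_) (∑-*ˡ xs c f)) (sym (*-distribˡ-+ c (f x) (∑ℚ xs f)))

  ∑-*ʳ : ∀ (xs : List A) c (f : A → ℚ) → ∑[ x ∈ xs ] (f x * c) ≡ ∑ℚ xs f * c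
  ∑-*ʳ xs c f = trans (∑-cong xs (λ x → *-comm (f x) c)) (trans (∑-*ˡ xs c f) (*-comm c (∑ℚ xs f)))

  ∑-const : ∀ (xs : List A) c → ∑[ _ ∈ xs ] c ≡ ι (length xs) * c
  ∑-const []       c = sym (*-zeroˡ c)
  ∑-const (x ∷ xs) c = trans (cong (c +_) (∑-const xs c))
    (trans (solve 2 (λ a b → b :+ a :* b := (con 1ℚ :+ a) :* b) refl (ι (length xs)) c) (cong (_* c) (sym (ι-suc (length xs)))))

  ∑-zero : ∀ (xs : List A) → ∑[ _ ∈ xs ] 0ℚ ≡ 0ℚ
  ∑-zero xs = trans (∑-const xs 0ℚ) (*-zeroʳ (ι (length xs)))

  ∑-swap : ∀ (xs : List A) (ys : List B) (h : A → B → ℚ) →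
    ∑[ x ∈ xs ] ∑[ y ∈ ys ] h x y ≡ ∑[ y ∈ ys ] ∑[ x ∈ xs ] h x y
  ∑-swap []       ys h = sym (∑-zero ys)
  ∑-swap (x ∷ xs) ys h = trans (cong (∑ℚ ys (h x) +_) (∑-swap xs ys h))
    (sym (∑-distrib-+ ys (h x) (λ y → ∑[ x ∈ xs ] h x y)))

  ∑-∣∣ : ∀ (xs : List A) (f : A → ℚ) → ∣ ∑ℚ xs f ∣ ≤ ∑[ x ∈ xs ] ∣ f x ∣
  ∑-∣∣ []       f = ≤-refl
  ∑-∣∣ (x ∷ xs) f = ≤-trans (∣p+q∣≤∣p∣+∣q∣ (f x) (∑ℚ xs f)) (+-monoʳ-≤ ∣ f x ∣ (∑-∣∣ xs f))

  ∑-++ : ∀ (xs ys : List A) (f : A → ℚ) → ∑ℚ (xs ++ ys) f ≡ ∑ℚ xs f + ∑ℚ ys f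
  ∑-++ []       ys f = sym (+-identityˡ (∑ℚ ys f))
  ∑-++ (x ∷ xs) ys f = trans (cong (f x +_) (∑-++ xs ys f)) (sym (+-assoc (f x) (∑ℚ xs f) (∑ℚ ys f)))

  ∑-map : ∀ (h : A → B) xs (f : B → ℚ) → ∑ℚ (List.map h xs) f ≡ ∑ℚ xs (f ∘ h)
  ∑-map h []       f = refl
  ∑-map h (x ∷ xs) f = cong (f (h x) +_) (∑-map h xs f)

  ∑-concatMap : ∀ (h : A → List B) xs (f : B → ℚ) → ∑ℚ (concatMap h xs) f ≡ ∑[ x ∈ xs ] ∑ℚ (h x) f
  ∑-concatMap h []       f = refl
  ∑-concatMap h (x ∷ xs) f = trans (∑-++ (h x) (concatMap h xs) f) (cong (∑ℚ (h x) f +_) (∑-concatMap h xs f))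

  ∑-allFin : ∀ n (f : Fin (suc n) → ℚ) → ∑ℚ (allFin (suc n)) f ≡ f zero + ∑ℚ (allFin n) (f ∘ suc)
  ∑-allFin n f = cong (f zero +_) (trans (cong (λ xs → ∑ℚ xs f) (sym (Listₚ.map-tabulate id suc))) (∑-map suc (allFin n) f))

  -- Cauchy-Schwarz against the constant 1. The cross terms of the new entry with the rest are split
  -- one by one by 2xy ≤ x² + y², so no division or root occurs.
  sq-∑ : ∀ (xs : List A) (f : A → ℚ) → sq (∑ℚ xs f) ≤ ι (length xs) * (∑[ x ∈ xs ] sq (f x))
  sq-∑ []       f = ≤-refl
  sq-∑ (x ∷ xs) f = begin
    sq (a + S)                              ≡⟨ solve 2 (λ a s → (a :+ s) :* (a :+ s) := a :* a :+ (a :* s :+ a :* s) :+ s :* s) refl a S ⟩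
    a * a + (a * S + a * S) + sq S          ≤⟨ +-mono-≤ (+-monoʳ-≤ (a * a) (cross xs)) (sq-∑ xs f) ⟩
    a * a + (n * (a * a) + T) + n * T       ≡⟨ solve 3 (λ a n t → a :+ (n :* a :+ t) :+ n :* t := (con 1ℚ :+ n) :* (a :+ t)) refl (a * a) n T ⟩
    (1ℚ + n) * (a * a + T)                  ≡⟨ cong (_* (a * a + T)) (sym (ι-suc (length xs))) ⟩
    ι (length (x ∷ xs)) * (a * a + T)       ∎
    where
    open ≤-Reasoning
    a = f x
    S = ∑ℚ xs f
    n = ι (length xs)
    T = ∑[ x ∈ xs ] sq (f x)
    cross : ∀ ys → a * ∑ℚ ys f + a * ∑ℚ ys f ≤ ι (length ys) * (a * a) + ∑ℚ ys (sq ∘ f)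
    cross []       = ≤-reflexive (solve 1 (λ a → a :* con 0ℚ :+ a :* con 0ℚ := con 0ℚ :* (a :* a) :+ con 0ℚ) refl a)
    cross (y ∷ ys) = begin
      a * (f y + ∑ℚ ys f) + a * (f y + ∑ℚ ys f)
        ≡⟨ solve 3 (λ a b s → a :* (b :+ s) :+ a :* (b :+ s) := (a :* b :+ a :* b) :+ (a :* s :+ a :* s)) refl a (f y) (∑ℚ ys f) ⟩
      (a * f y + a * f y) + (a * ∑ℚ ys f + a * ∑ℚ ys f)
        ≤⟨ +-mono-≤ (2xy≤x²+y² a (f y)) (cross ys) ⟩
      (a * a + f y * f y) + (ι (length ys) * (a * a) + ∑ℚ ys (sq ∘ f))
        ≡⟨ solve 4 (λ a b n t → (a :+ b) :+ (n :* a :+ t) := (con 1ℚ :+ n) :* a :+ (b :+ t)) refl (a * a) (sq (f y)) (ι (length ys)) (∑ℚ ys (sq ∘ f)) ⟩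
      (1ℚ + ι (length ys)) * (a * a) + (sq (f y) + ∑ℚ ys (sq ∘ f))
        ≡⟨ cong (λ k → k * (a * a) + (sq (f y) + ∑ℚ ys (sq ∘ f))) (sym (ι-suc (length ys))) ⟩
      ι (length (y ∷ ys)) * (a * a) + (sq (f y) + ∑ℚ ys (sq ∘ f)) ∎

  -- If the head is not a witness, removing it only improves the comparison of the remaining sums.
  ∑-pigeonhole : ∀ (xs : List A) (f g : A → ℚ) → 0 ℕ.< length xs → ∑ℚ xs f ≤ ∑ℚ xs g → ∃ λ x → f x ≤ g x
  ∑-pigeonhole (x ∷ xs) f g _ = go x xs
    where
    go : ∀ x xs → ∑ℚ (x ∷ xs) f ≤ ∑ℚ (x ∷ xs) g → ∃ λ x → f x ≤ g x
    go x []       h = x , subst₂ _≤_ (+-identityʳ (f x)) (+-identityʳ (g x)) h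
    go x (y ∷ ys) h with ≤-total (f x) (g x)
    ... | inj₁ f≤g = x , f≤g
    ... | inj₂ g≤f = go y ys (0≤y-x⇒x≤y (subst (0ℚ ≤_)
          (solve 4 (λ a s b t → ((b :+ t) :- (a :+ s)) :+ (a :- b) := t :- s) refl (f x) (∑ℚ (y ∷ ys) f) (g x) (∑ℚ (y ∷ ys) g))
          (+-nonNeg (x≤y⇒0≤y-x h) (x≤y⇒0≤y-x g≤f))))

  vecs : List A → ∀ n → List (Vec A n)
  vecs xs zero    = [] ∷ []
  vecs xs (suc n) = concatMap (λ x → List.map (x ∷_) (vecs xs n)) xs

  ∑-vecs : ∀ (xs : List A) n (f : Vec A (suc n) → ℚ) →
    ∑ℚ (vecs xs (suc n)) f ≡ ∑[ x ∈ xs ] ∑[ v ∈ vecs xs n ] f (x ∷ v)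
  ∑-vecs xs n f = trans (∑-concatMap _ xs f) (∑-cong xs (λ x → ∑-map (x ∷_) (vecs xs n) f))

  length-vecs : ∀ (xs : List A) n → length (vecs xs n) ≡ length xs ℕ.^ n
  length-vecs xs zero    = refl
  length-vecs xs (suc n) = go xs
    where
    go : ∀ ys → length (concatMap (λ x → List.map (x ∷_) (vecs xs n)) ys) ≡ length ys ℕ.* length xs ℕ.^ n
    go []       = refl
    go (y ∷ ys) = trans (Listₚ.length-++ (List.map (y ∷_) (vecs xs n)))
      (cong₂ ℕ._+_ (trans (Listₚ.length-map (y ∷_) (vecs xs n)) (length-vecs xs n)) (go ys))

  ∑-product : ∀ {A B : Set} (xs : List A) (ys : List B) (f : A → ℚ) (g : B → ℚ) →
    ∑ℚ xs f * ∑ℚ ys g ≡ ∑[ x ∈ xs ] ∑[ y ∈ ys ] f x * g y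
  ∑-product xs ys f g = trans (sym (∑-*ʳ xs (∑ℚ ys g) f)) (∑-cong xs (λ x → sym (∑-*ˡ ys (f x) g)))

  -- Private-coin protocols and the box bound on correlation.

  -- These weights replace indicator functions: with private coins, the inputs reaching a leaf form
  -- only a fractional rectangle.
  Unit : {A : Set} → (A → ℚ) → Set
  Unit a = ∀ x → (0ℚ ≤ a x) × (a x ≤ 1ℚ)

  unit-* : {A : Set} {a b : A → ℚ} → Unit a → Unit b → Unit (λ x → a x * b x)
  unit-* ua ub x = *-nonNeg (proj₁ (ua x)) (proj₁ (ub x)) ,
    *-mono-≤-nonNeg (proj₁ (ua x)) (proj₂ (ua x)) (proj₁ (ub x)) (proj₂ (ub x))

  unit-complement : {A : Set} {a : A → ℚ} → Unit a → Unit (λ x → 1ℚ - a x)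
  unit-complement ua x = x≤y⇒0≤y-x (proj₂ (ua x)) , +-monoʳ-≤ 1ℚ (neg-antimono-≤ (proj₁ (ua x)))

  sq-unit-* : 0ℚ ≤ x → x ≤ 1ℚ → ∀ y → sq (x * y) ≤ sq y
  sq-unit-* {x} 0≤x x≤1 y = subst₂ _≤_ (sym (sq-* x y)) (*-identityˡ (sq y))
    (*-monoʳ-≤′ (0≤x² y) (*-mono-≤-nonNeg 0≤x x≤1 0≤x x≤1))

  sq-sq-+ : ∀ x y → sq (sq (x + y)) ≤ ι 8 * (sq (sq x) + sq (sq y))
  sq-sq-+ x y = begin
    sq (sq (x + y))                    ≤⟨ sq-mono (0≤x² (x + y)) (sq-+ x y) ⟩
    sq ((X + Y) + (X + Y))             ≡⟨ solve 1 (λ s → (s :+ s) :* (s :+ s) := con (ι 4) :* (s :* s)) refl (X + Y) ⟩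
    ι 4 * sq (X + Y)                   ≤⟨ *-monoˡ-≤′ (0≤ι 4) (sq-+ X Y) ⟩
    ι 4 * ((sq X + sq Y) + (sq X + sq Y)) ≡⟨ solve 1 (λ s → con (ι 4) :* (s :+ s) := con (ι 8) :* s) refl (sq X + sq Y) ⟩
    ι 8 * (sq X + sq Y)                ∎
    where
    open ≤-Reasoning
    X = sq x
    Y = sq y

  probOut-total : ∀ {X Y} (P : Protocol X Y) x y → probOut P x y false + probOut P x y true ≡ 1ℚ
  probOut-total (leaf false) x y = refl
  probOut-total (leaf true)  x y = refl
  probOut-total (alice p _ P₀ P₁) x y = trans
    (solve 5 (λ p a b c d → (p :* a :+ (con 1ℚ :- p) :* b) :+ (p :* c :+ (con 1ℚ :- p) :* d)
                         := p :* (a :+ c) :+ (con 1ℚ :- p) :* (b :+ d)) refl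
       (p x) (probOut P₁ x y false) (probOut P₀ x y false) (probOut P₁ x y true) (probOut P₀ x y true))
    (trans (cong₂ (λ s t → p x * s + (1ℚ - p x) * t) (probOut-total P₁ x y) (probOut-total P₀ x y))
       (solve 1 (λ p → p :* con 1ℚ :+ (con 1ℚ :- p) :* con 1ℚ := con 1ℚ) refl (p x)))
  probOut-total (bob p _ P₀ P₁) x y = trans
    (solve 5 (λ p a b c d → (p :* a :+ (con 1ℚ :- p) :* b) :+ (p :* c :+ (con 1ℚ :- p) :* d)
                         := p :* (a :+ c) :+ (con 1ℚ :- p) :* (b :+ d)) refl
       (p y) (probOut P₁ x y false) (probOut P₀ x y false) (probOut P₁ x y true) (probOut P₀ x y true))
    (trans (cong₂ (λ s t → p y * s + (1ℚ - p y) * t) (probOut-total P₁ x y) (probOut-total P₀ x y))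
       (solve 1 (λ p → p :* con 1ℚ :+ (con 1ℚ :- p) :* con 1ℚ := con 1ℚ) refl (p y)))

  probOut-nonNeg : ∀ {X Y} (P : Protocol X Y) x y b → 0ℚ ≤ probOut P x y b
  probOut-nonNeg (leaf false) x y false = 0≤1
  probOut-nonNeg (leaf false) x y true  = ≤-refl
  probOut-nonNeg (leaf true)  x y false = ≤-refl
  probOut-nonNeg (leaf true)  x y true  = 0≤1
  probOut-nonNeg (alice p u P₀ P₁) x y b = +-nonNeg
    (*-nonNeg (proj₁ (u x)) (probOut-nonNeg P₁ x y b))
    (*-nonNeg (proj₁ (unit-complement u x)) (probOut-nonNeg P₀ x y b))
  probOut-nonNeg (bob p u P₀ P₁) x y b = +-nonNeg
    (*-nonNeg (proj₁ (u y)) (probOut-nonNeg P₁ x y b))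
    (*-nonNeg (proj₁ (unit-complement u y)) (probOut-nonNeg P₀ x y b))

  probOut≤1 : ∀ {X Y} (P : Protocol X Y) x y b → probOut P x y b ≤ 1ℚ
  probOut≤1 P x y false = subst₂ _≤_ (+-identityʳ _) (probOut-total P x y)
    (+-monoʳ-≤ (probOut P x y false) (probOut-nonNeg P x y true))
  probOut≤1 P x y true = subst₂ _≤_ (+-identityˡ _) (probOut-total P x y)
    (+-monoˡ-≤ (probOut P x y true) (probOut-nonNeg P x y false))

  -- The expected output in the ±1 encoding, where `false` is +1.
  bias : ∀ {X Y} → Protocol X Y → X → Y → ℚ
  bias P x y = probOut P x y false - probOut P x y true

  module Discrepancy {X Y : Set} (xs : List X) (ys : List Y) (ν : X → Y → ℚ) where

    correlation : (X → ℚ) → (Y → ℚ) → (X → Y → ℚ) → ℚ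
    correlation a b h = ∑[ x ∈ xs ] ∑[ y ∈ ys ] (a x * b y) * (ν x y * h x y)

    mass : ℚ
    mass = ∑[ x ∈ xs ] ∑[ y ∈ ys ] ∣ ν x y ∣

    kernel : Y → Y → ℚ
    kernel y y′ = ∑[ x ∈ xs ] ν x y * ν x y′

    -- The fourth power of the unnormalised box norm of `ν`: squaring `kernel` supplies the second
    -- `x`, so that the sum runs over the four corners of all rectangles.
    box : ℚ
    box = ∑[ y ∈ ys ] ∑[ y′ ∈ ys ] sq (kernel y y′)

    boxBound : ℚ
    boxBound = sq (ι (length xs)) * (sq (ι (length ys)) * box)

    box-nonNeg : 0ℚ ≤ box
    box-nonNeg = ∑-nonNeg ys (λ y → ∑-nonNeg ys (λ y′ → 0≤x² (kernel y y′)))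

    boxBound-nonNeg : 0ℚ ≤ boxBound
    boxBound-nonNeg = *-nonNeg (0≤x² (ι (length xs))) (*-nonNeg (0≤x² (ι (length ys))) box-nonNeg)

    -- Cauchy-Schwarz over `x` discards `a`, whose values are at most 1. Expanding the remaining
    -- squares gives a sum over pairs `y`, `y′`, and Cauchy-Schwarz over these pairs discards
    -- `b y * b y′`.
    rectangle-bound : ∀ {a b} → Unit a → Unit b → sq (sq (correlation a b (λ _ _ → 1ℚ))) ≤ boxBound
    rectangle-bound {a} {b} ua ub = begin
      sq (sq (correlation a b (λ _ _ → 1ℚ)))   ≤⟨ sq-mono (0≤x² (correlation a b (λ _ _ → 1ℚ))) step₁ ⟩
      sq (nX * (∑[ x ∈ xs ] sq (S x)))         ≡⟨ sq-* nX (∑[ x ∈ xs ] sq (S x)) ⟩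
      sq nX * sq (∑[ x ∈ xs ] sq (S x))        ≡⟨ cong (λ e → sq nX * sq e) expand ⟩
      sq nX * sq (∑[ y ∈ ys ] ∑[ y′ ∈ ys ] (b y * b y′) * kernel y y′)
                                               ≤⟨ *-monoˡ-≤′ (0≤x² nX) step₂ ⟩
      boxBound                                 ∎
      where
      open ≤-Reasoning
      nX = ι (length xs)
      nY = ι (length ys)
      S : X → ℚ
      S x = ∑[ y ∈ ys ] b y * ν x y
      step₁ : sq (correlation a b (λ _ _ → 1ℚ)) ≤ nX * (∑[ x ∈ xs ] sq (S x))
      step₁ = begin
        sq (correlation a b (λ _ _ → 1ℚ))
          ≡⟨ cong sq (∑-cong xs (λ x → trans
               (∑-cong ys (λ y → solve 3 (λ a b n → (a :* b) :* (n :* con 1ℚ) := a :* (b :* n)) refl (a x) (b y) (ν x y)))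
               (∑-*ˡ ys (a x) _))) ⟩
        sq (∑[ x ∈ xs ] a x * S x)          ≤⟨ sq-∑ xs _ ⟩
        nX * (∑[ x ∈ xs ] sq (a x * S x))
          ≤⟨ *-monoˡ-≤′ (0≤ι (length xs)) (∑-mono xs (λ x → sq-unit-* (proj₁ (ua x)) (proj₂ (ua x)) (S x))) ⟩
        nX * (∑[ x ∈ xs ] sq (S x))         ∎
      expand : ∑[ x ∈ xs ] sq (S x) ≡ ∑[ y ∈ ys ] ∑[ y′ ∈ ys ] (b y * b y′) * kernel y y′
      expand = trans (∑-cong xs (λ x → ∑-product ys ys _ _))
        (trans (∑-swap xs ys _) (∑-cong ys (λ y →
          trans (∑-swap xs ys _) (∑-cong ys (λ y′ →
            trans (∑-cong xs (λ x → solve 4 (λ b n c m → (b :* n) :* (c :* m) := (b :* c) :* (n :* m)) refl (b y) (ν x y) (b y′) (ν x y′)))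
              (∑-*ˡ xs (b y * b y′) _))))))
      step₂ : sq (∑[ y ∈ ys ] ∑[ y′ ∈ ys ] (b y * b y′) * kernel y y′) ≤ sq nY * box
      step₂ = begin
        sq (∑[ y ∈ ys ] ∑[ y′ ∈ ys ] (b y * b y′) * kernel y y′)
          ≤⟨ sq-∑ ys _ ⟩
        nY * (∑[ y ∈ ys ] sq (∑[ y′ ∈ ys ] (b y * b y′) * kernel y y′))
          ≤⟨ *-monoˡ-≤′ (0≤ι (length ys)) (∑-mono ys (λ y → ≤-trans (sq-∑ ys _) (*-monoˡ-≤′ (0≤ι (length ys))
               (∑-mono ys (λ y′ → sq-unit-* (proj₁ (ubb y y′)) (proj₂ (ubb y y′)) (kernel y y′)))))) ⟩
        nY * (∑[ y ∈ ys ] nY * (∑[ y′ ∈ ys ] sq (kernel y y′)))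
          ≡⟨ cong (nY *_) (∑-*ˡ ys nY _) ⟩
        nY * (nY * box)                     ≡⟨ sym (*-assoc nY nY box) ⟩
        sq nY * box                         ∎
        where
        ubb : ∀ y → Unit (λ y′ → b y * b y′)
        ubb y = unit-* (λ _ → ub y) ub

    correlation-cong : ∀ {a a′ b b′ h h′} →
      (∀ x y → (a x * b y) * (ν x y * h x y) ≡ (a′ x * b′ y) * (ν x y * h′ x y)) →
      correlation a b h ≡ correlation a′ b′ h′
    correlation-cong e = ∑-cong xs (λ x → ∑-cong ys (e x))

    correlation-split : ∀ {a b h a₁ b₁ h₁ a₂ b₂ h₂} →
      (∀ x y → (a x * b y) * (ν x y * h x y) ≡ (a₁ x * b₁ y) * (ν x y * h₁ x y) + (a₂ x * b₂ y) * (ν x y * h₂ x y)) →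
      correlation a b h ≡ correlation a₁ b₁ h₁ + correlation a₂ b₂ h₂
    correlation-split e = trans (∑-cong xs (λ x → trans (∑-cong ys (e x)) (∑-distrib-+ ys _ _))) (∑-distrib-+ xs _ _)

    -- Each level of the tree costs a factor 16: 8 from the convexity bound `sq-sq-+`, doubled by
    -- the two children. This is the fourth power of the usual factor 2 per bit.
    node-bound : ∀ {c : ℚ} m n {c₀ c₁ : ℚ} → c ≡ c₁ + c₀ →
      sq (sq c₀) ≤ ι (16 ℕ.^ m) * boxBound → sq (sq c₁) ≤ ι (16 ℕ.^ n) * boxBound →
      sq (sq c) ≤ ι (16 ℕ.^ suc (m ℕ.⊔ n)) * boxBound
    node-bound m n {c₀} {c₁} refl h₀ h₁ = begin
      sq (sq (c₁ + c₀))                   ≤⟨ sq-sq-+ c₁ c₀ ⟩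
      ι 8 * (sq (sq c₁) + sq (sq c₀))     ≤⟨ *-monoˡ-≤′ (0≤ι 8) (+-mono-≤
          (≤-trans h₁ (*-monoʳ-≤′ boxBound-nonNeg (ι-mono (ℕₚ.^-monoʳ-≤ 16 (ℕₚ.m≤n⊔m m n)))))
          (≤-trans h₀ (*-monoʳ-≤′ boxBound-nonNeg (ι-mono (ℕₚ.^-monoʳ-≤ 16 (ℕₚ.m≤m⊔n m n)))))) ⟩
      ι 8 * (K * boxBound + K * boxBound) ≡⟨ solve 2 (λ k b → con (ι 8) :* (k :* b :+ k :* b) := (con (ι 16) :* k) :* b) refl K boxBound ⟩
      (ι 16 * K) * boxBound               ≡⟨ cong (_* boxBound) (sym (ι-* 16 (16 ℕ.^ (m ℕ.⊔ n)))) ⟩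
      ι (16 ℕ.^ suc (m ℕ.⊔ n)) * boxBound ∎
      where
      open ≤-Reasoning
      K = ι (16 ℕ.^ (m ℕ.⊔ n))

    -- The weights `a` and `b` are general for the sake of the induction: a branch probability
    -- depends on one party's input alone and is absorbed into that party's weight, so coins need
    -- not be fixed in advance.
    protocol-bound : ∀ P {a b} → Unit a → Unit b →
      sq (sq (correlation a b (bias P))) ≤ ι (16 ℕ.^ cost P) * boxBound
    protocol-bound (leaf false) {a} {b} ua ub = subst₂ _≤_
      (cong (λ e → sq (sq e)) (correlation-cong {a} {a} {b} {b} {λ _ _ → 1ℚ} {bias {X} {Y} (leaf false)} (λ _ _ → refl)))
      (sym (*-identityˡ boxBound)) (rectangle-bound ua ub)
    protocol-bound (leaf true) {a} {b} ua ub = subst₂ _≤_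
      -- The output -1 merely negates the correlation, and the fourth power is even.
      (trans (solve 1 (λ s → (s :* s) :* (s :* s) := ((:- s) :* (:- s)) :* ((:- s) :* (:- s))) refl
                (correlation a b (λ _ _ → 1ℚ)))
         (cong (λ e → sq (sq e)) neg-correlation))
      (sym (*-identityˡ boxBound)) (rectangle-bound ua ub)
      where
      neg-correlation : - correlation a b (λ _ _ → 1ℚ) ≡ correlation a b (bias {X} {Y} (leaf true))
      neg-correlation = trans
        (solve 1 (λ s → :- s := con (- 1ℚ) :* s) refl (correlation a b (λ _ _ → 1ℚ)))
        (trans (sym (∑-*ˡ xs (- 1ℚ) _)) (∑-cong xs (λ x → trans (sym (∑-*ˡ ys (- 1ℚ) _)) (∑-cong ys (λ y →
          solve 3 (λ a b n → con (- 1ℚ) :* ((a :* b) :* (n :* con 1ℚ)) := (a :* b) :* (n :* con (- 1ℚ))) refl (a x) (b y) (ν x y))))))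
    protocol-bound (alice p u P₀ P₁) {a} {b} ua ub = node-bound (cost P₀) (cost P₁)
      {correlation (λ x → a x * (1ℚ - p x)) b (bias P₀)} {correlation (λ x → a x * p x) b (bias P₁)}
      (correlation-split {a = a} {b} {bias (alice p u P₀ P₁)} {λ x → a x * p x} {b₁ = b} {h₁ = bias P₁} {a₂ = λ x → a x * (1ℚ - p x)} {b₂ = b} {h₂ = bias P₀} (λ x y →
        solve 8 (λ a b n p c d e f →
          (a :* b) :* (n :* ((p :* c :+ (con 1ℚ :- p) :* d) :- (p :* e :+ (con 1ℚ :- p) :* f))) :=
          ((a :* p) :* b) :* (n :* (c :- e)) :+ ((a :* (con 1ℚ :- p)) :* b) :* (n :* (d :- f))) refl
          (a x) (b y) (ν x y) (p x) (probOut P₁ x y false) (probOut P₀ x y false) (probOut P₁ x y true) (probOut P₀ x y true)))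
      (protocol-bound P₀ (unit-* ua (unit-complement u)) ub)
      (protocol-bound P₁ (unit-* ua u) ub)
    protocol-bound (bob p u P₀ P₁) {a} {b} ua ub = node-bound (cost P₀) (cost P₁)
      {correlation a (λ y → b y * (1ℚ - p y)) (bias P₀)} {correlation a (λ y → b y * p y) (bias P₁)}
      (correlation-split {a = a} {b} {bias (bob p u P₀ P₁)} {a} {b₁ = λ y → b y * p y} {h₁ = bias P₁} {a₂ = a} {b₂ = λ y → b y * (1ℚ - p y)} {h₂ = bias P₀} (λ x y →
        solve 8 (λ a b n p c d e f →
          (a :* b) :* (n :* ((p :* c :+ (con 1ℚ :- p) :* d) :- (p :* e :+ (con 1ℚ :- p) :* f))) :=
          (a :* (b :* p)) :* (n :* (c :- e)) :+ (a :* (b :* (con 1ℚ :- p))) :* (n :* (d :- f))) refl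
          (a x) (b y) (ν x y) (p y) (probOut P₁ x y false) (probOut P₀ x y false) (probOut P₁ x y true) (probOut P₀ x y true)))
      (protocol-bound P₀ ua (unit-* ub (unit-complement u)))
      (protocol-bound P₁ ua (unit-* ub u))

    -- Both inequalities are weak, so zeros of `ν` are unconstrained. This matters because the
    -- threshold measure vanishes except at two values of the dot product.
    Signs : (X → Y → Bool) → Set
    Signs G = ∀ x y → (G x y ≡ false → 0ℚ ≤ ν x y) × (G x y ≡ true → ν x y ≤ 0ℚ)

    -- Being right with probability at least ½ + ε means that the bias, taken with the sign of `G`,
    -- is at least 2ε. Each pair therefore contributes at least 2ε times its mass to the
    -- correlation, to which `protocol-bound` applies with trivial weights.
    advantage-bound : ∀ P G ε → Signs G → 0ℚ ≤ ε → Computes P G ε →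
      sq (sq ((ε + ε) * mass)) ≤ ι (16 ℕ.^ cost P) * boxBound
    advantage-bound P G ε signs 0≤ε computes = ≤-trans
      (sq-mono (0≤x² ((ε + ε) * mass)) (sq-mono 0≤2εm lower))
      (protocol-bound P one one)
      where
      one : ∀ {A : Set} → Unit {A} (λ _ → 1ℚ)
      one _ = 0≤1 , ≤-refl
      0≤2ε : 0ℚ ≤ ε + ε
      0≤2ε = +-nonNeg 0≤ε 0≤ε
      0≤2εm : 0ℚ ≤ (ε + ε) * mass
      0≤2εm = *-nonNeg 0≤2ε (∑-nonNeg xs (λ x → ∑-nonNeg ys (λ y → 0≤∣p∣ (ν x y))))
      gap : ∀ s t → s + t ≡ 1ℚ → ½ + ε ≤ s → ε + ε ≤ s - t
      gap s t e h = 0≤y-x⇒x≤y (subst (0ℚ ≤_)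
        (trans (solve 3 (λ s t ε → (s :- (con ½ :+ ε)) :+ (s :- (con ½ :+ ε)) := (s :- t :- (ε :+ ε)) :+ ((s :+ t) :- con 1ℚ)) refl s t ε)
          (trans (cong (λ r → (s - t - (ε + ε)) + (r - 1ℚ)) e) (+-identityʳ _)))
        (+-nonNeg (x≤y⇒0≤y-x h) (x≤y⇒0≤y-x h)))
      pointwise : ∀ x y → (ε + ε) * ∣ ν x y ∣ ≤ ν x y * bias P x y
      pointwise x y with G x y in eq | computes x y
      ... | false | h = subst (λ r → (ε + ε) * r ≤ ν x y * bias P x y) (sym (0≤p⇒∣p∣≡p 0≤ν))
            (subst (_≤ ν x y * bias P x y) (*-comm (ν x y) (ε + ε))
              (*-monoˡ-≤′ 0≤ν (gap _ _ (probOut-total P x y) h)))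
        where 0≤ν = proj₁ (signs x y) eq
      ... | true | h = subst₂ _≤_
            (trans (*-comm (- ν x y) (ε + ε)) (cong ((ε + ε) *_) (trans (sym (0≤p⇒∣p∣≡p 0≤-ν)) (∣-p∣≡∣p∣ (ν x y)))))
            (solve 3 (λ n a b → (:- n) :* (b :- a) := n :* (a :- b)) refl (ν x y) (probOut P x y false) (probOut P x y true))
            (*-monoˡ-≤′ 0≤-ν (gap (probOut P x y true) (probOut P x y false) (trans (+-comm (probOut P x y true) (probOut P x y false)) (probOut-total P x y)) h))
        where 0≤-ν = neg-antimono-≤ (proj₂ (signs x y) eq)
      lower : (ε + ε) * mass ≤ correlation (λ _ → 1ℚ) (λ _ → 1ℚ) (bias P)
      lower = subst (_≤ correlation (λ _ → 1ℚ) (λ _ → 1ℚ) (bias P))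
        (trans (∑-cong xs (λ x → ∑-*ˡ ys (ε + ε) _)) (∑-*ˡ xs (ε + ε) _))
        (∑-mono xs (λ x → ∑-mono ys (λ y → subst ((ε + ε) * ∣ ν x y ∣ ≤_)
          (sym (*-identityˡ (ν x y * bias P x y))) (pointwise x y))))

  -- Point masses on the natural numbers and their differences.

  ∑-range-head : ∀ n .{{_ : ℕ.NonZero n}} (f : ℕ → ℚ) → (∀ t → 0ℚ ≤ f t) → f 0 ≤ ∑[ t ∈ allFin n ] f (toℕ t)
  ∑-range-head (suc n) f 0≤f = subst₂ _≤_ (+-identityʳ (f 0)) (sym (∑-allFin n (λ t → f (toℕ t))))
    (+-monoʳ-≤ (f 0) (∑-nonNeg (allFin n) (λ t → 0≤f (suc (toℕ t)))))

  ∑-range-const : ∀ n c → ∑[ _ ∈ allFin n ] c ≡ ι n * c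
  ∑-range-const n c = trans (∑-const (allFin n) c) (cong (λ l → ι l * c) (Listₚ.length-tabulate {n = n} id))

  δ : ℕ → ℕ → ℚ
  δ zero    zero    = 1ℚ
  δ zero    (suc _) = 0ℚ
  δ (suc _) zero    = 0ℚ
  δ (suc a) (suc b) = δ a b

  0≤δ : ∀ a b → 0ℚ ≤ δ a b
  0≤δ zero    zero    = 0≤1
  0≤δ zero    (suc _) = ≤-refl
  0≤δ (suc _) zero    = ≤-refl
  0≤δ (suc a) (suc b) = 0≤δ a b

  ∑-δ≤1 : ∀ n x θ → ∑[ t ∈ allFin n ] δ (toℕ t ℕ.+ x) θ ≤ 1ℚ
  ∑-δ≤1 zero    x       θ       = 0≤1
  ∑-δ≤1 (suc n) zero    zero    = ≤-reflexive
    (trans (∑-allFin n (λ t → δ (toℕ t ℕ.+ zero) zero)) (cong (1ℚ +_) (∑-zero (allFin n))))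
  ∑-δ≤1 (suc n) (suc x) zero    = ≤-trans (≤-reflexive
    (trans (∑-allFin n (λ t → δ (toℕ t ℕ.+ suc x) zero)) (cong (0ℚ +_) (∑-zero (allFin n))))) 0≤1
  ∑-δ≤1 (suc n) zero    (suc θ) = ≤-trans (≤-reflexive
    (trans (∑-allFin n (λ t → δ (toℕ t ℕ.+ zero) (suc θ))) (+-identityˡ (∑[ t ∈ allFin n ] δ (toℕ t ℕ.+ zero) θ)))) (∑-δ≤1 n zero θ)
  ∑-δ≤1 (suc n) (suc x) (suc θ) = subst (_≤ 1ℚ)
    (∑-cong (allFin (suc n)) (λ t → sym (cong (λ s → δ s (suc θ)) (ℕₚ.+-suc (toℕ t) x)))) (∑-δ≤1 (suc n) x θ)

  ∑-δ≡1 : ∀ {n s} → s ℕ.< n → ∑[ θ ∈ allFin n ] δ s (toℕ θ) ≡ 1ℚ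
  ∑-δ≡1 {suc n} {zero}  _           = trans (∑-allFin n (λ θ → δ zero (toℕ θ))) (cong (1ℚ +_) (∑-zero (allFin n)))
  ∑-δ≡1 {suc n} {suc s} (ℕ.s≤s s<n) = trans (∑-allFin n (λ θ → δ (suc s) (toℕ θ)))
    (trans (+-identityˡ (∑[ θ ∈ allFin n ] δ s (toℕ θ))) (∑-δ≡1 s<n))

  -- +1 at `θ` and -1 at `θ - 1`, written as a difference of one function at consecutive arguments
  -- so that sums over a weight telescope. For `θ` = 0 the negative point is absent.
  jump : ℕ → ℕ → ℚ
  jump θ x = δ x θ - δ (suc x) θ

  -- Quadruples of cube points and their coordinate patterns.

  bools : List Bool
  bools = false ∷ true ∷ []

  cube : ∀ n → List (Vec Bool n)
  cube = vecs bools

  ∑-vecs² : ∀ {A : Set} (xs : List A) n (h : Vec A (suc n) → Vec A (suc n) → ℚ) →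
    ∑[ v ∈ vecs xs (suc n) ] ∑[ v′ ∈ vecs xs (suc n) ] h v v′ ≡
    ∑[ b ∈ xs ] ∑[ b′ ∈ xs ] ∑[ v ∈ vecs xs n ] ∑[ v′ ∈ vecs xs n ] h (b ∷ v) (b′ ∷ v′)
  ∑-vecs² xs n h = trans (∑-vecs xs n _) (∑-cong xs (λ b →
    trans (∑-cong (vecs xs n) (λ v → ∑-vecs xs n _)) (∑-swap (vecs xs n) xs _)))

  ∑-swap² : ∀ {A B C D : Set} (as : List A) (bs : List B) (cs : List C) (ds : List D) (h : A → B → C → D → ℚ) →
    ∑[ a ∈ as ] ∑[ b ∈ bs ] ∑[ c ∈ cs ] ∑[ d ∈ ds ] h a b c d ≡
    ∑[ c ∈ cs ] ∑[ d ∈ ds ] ∑[ a ∈ as ] ∑[ b ∈ bs ] h a b c d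
  ∑-swap² as bs cs ds h = trans
    (∑-cong as (λ a → trans (∑-swap bs cs _) (∑-cong cs (λ c → ∑-swap bs ds _))))
    (trans (∑-swap as cs _) (∑-cong cs (λ c → ∑-swap as ds _)))

  -- The pair `v`, `v′` is outermost because `box` sums over pairs of columns first; patterns list
  -- their bits in the same order.
  ∑⁴ : ∀ n → (Vec Bool n → Vec Bool n → Vec Bool n → Vec Bool n → ℚ) → ℚ
  ∑⁴ n h = ∑[ v ∈ cube n ] ∑[ v′ ∈ cube n ] ∑[ u ∈ cube n ] ∑[ u′ ∈ cube n ] h u u′ v v′

  ∑⁴-mono : ∀ n {h h′} → (∀ u u′ v v′ → h u u′ v v′ ≤ h′ u u′ v v′) → ∑⁴ n h ≤ ∑⁴ n h′
  ∑⁴-mono n e = ∑-mono (cube n) (λ v → ∑-mono (cube n) (λ v′ → ∑-mono (cube n) (λ u → ∑-mono (cube n) (λ u′ → e u u′ v v′))))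

  ∑⁴-*ˡ : ∀ n c h → ∑⁴ n (λ u u′ v v′ → c * h u u′ v v′) ≡ c * ∑⁴ n h
  ∑⁴-*ˡ n c h = trans (∑-cong (cube n) (λ v → trans (∑-cong (cube n) (λ v′ →
    trans (∑-cong (cube n) (λ u → ∑-*ˡ (cube n) c _)) (∑-*ˡ (cube n) c _))) (∑-*ˡ (cube n) c _))) (∑-*ˡ (cube n) c _)

  ∑-∑⁴-swap : ∀ {A : Set} (xs : List A) n (h : A → Vec Bool n → Vec Bool n → Vec Bool n → Vec Bool n → ℚ) →
    ∑[ x ∈ xs ] ∑⁴ n (h x) ≡ ∑⁴ n (λ u u′ v v′ → ∑[ x ∈ xs ] h x u u′ v v′)
  ∑-∑⁴-swap xs n h = trans (∑-swap xs (cube n) _) (∑-cong (cube n) (λ v →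
    trans (∑-swap xs (cube n) _) (∑-cong (cube n) (λ v′ →
    trans (∑-swap xs (cube n) _) (∑-cong (cube n) (λ u → ∑-swap xs (cube n) _))))))

  ∑⁴-suc : ∀ n h → ∑⁴ (suc n) h ≡ ∑[ b ∈ bools ] ∑[ b′ ∈ bools ] ∑[ a ∈ bools ] ∑[ a′ ∈ bools ]
    ∑⁴ n (λ u u′ v v′ → h (a ∷ u) (a′ ∷ u′) (b ∷ v) (b′ ∷ v′))
  ∑⁴-suc n h = trans
    (∑-cong (cube (suc n)) (λ v → ∑-cong (cube (suc n)) (λ v′ → ∑-vecs² bools n (λ u u′ → h u u′ v v′))))
    (trans (∑-vecs² bools n _) (∑-cong bools (λ b → ∑-cong bools (λ b′ → ∑-swap² (cube n) (cube n) bools bools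
      (λ v v′ a a′ → ∑[ u ∈ cube n ] ∑[ u′ ∈ cube n ] h (a ∷ u) (a′ ∷ u′) (b ∷ v) (b′ ∷ v′))))))

  -- One coordinate of a quadruple of inputs, as (b , b′ , a , a′).
  Pattern : Set
  Pattern = Bool × Bool × Bool × Bool

  pick : Bool → Bool → ℚ → ℚ → ℚ
  pick false false x y = x
  pick false true  x y = y
  pick true  false x y = y
  pick true  true  x y = x

  -- Nesting one test per bit lets sums over all sixteen patterns be evaluated one bit at a time,
  -- while `select-elim` still yields equality of whole patterns.
  select : Pattern → Pattern → ℚ → ℚ → ℚ
  select (d₁ , d₂ , d₃ , d₄) (b , b′ , a , a′) x y = pick d₁ b (pick d₂ b′ (pick d₃ a (pick d₄ a′ x y) y) y) y

  pick-elim : ∀ (P : ℚ → Set) d b {x y} → (d ≡ b → P x) → P y → P (pick d b x y)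
  pick-elim P false false px py = px refl
  pick-elim P false true  px py = py
  pick-elim P true  false px py = py
  pick-elim P true  true  px py = px refl

  select-elim : ∀ (P : ℚ → Set) d p {x y} → (d ≡ p → P x) → P y → P (select d p x y)
  select-elim P (d₁ , d₂ , d₃ , d₄) (b , b′ , a , a′) px py =
    pick-elim P d₁ b (λ { refl → pick-elim P d₂ b′ (λ { refl → pick-elim P d₃ a (λ { refl →
      pick-elim P d₄ a′ (λ { refl → px refl }) py }) py }) py }) py

  ∑-select : ∀ d x y → ∑[ b ∈ bools ] ∑[ b′ ∈ bools ] ∑[ a ∈ bools ] ∑[ a′ ∈ bools ] select d (b , b′ , a , a′) x y
    ≡ x + ι 15 * y
  ∑-select (d₁ , d₂ , d₃ , d₄) x y = trans (four d₁)
    (solve 2 (λ x y → let y₂ = y :+ (y :+ con 0ℚ) ; y₄ = y₂ :+ (y₂ :+ con 0ℚ) in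
      (x :+ y) :+ y₂ :+ y₄ :+ (y₄ :+ (y₄ :+ con 0ℚ)) := x :+ con (ι 15) :* y) refl x y)
    where
    y₂ = ∑[ _ ∈ bools ] y
    y₄ = ∑[ _ ∈ bools ] y₂
    y₈ = ∑[ _ ∈ bools ] y₄
    one : ∀ d → ∑[ a′ ∈ bools ] pick d a′ x y ≡ x + y
    one false = cong (x +_) (+-identityʳ y)
    one true  = trans (cong (y +_) (+-identityʳ x)) (+-comm y x)
    two : ∀ d → ∑[ a ∈ bools ] ∑[ a′ ∈ bools ] pick d a (pick d₄ a′ x y) y ≡ (x + y) + y₂
    two false = cong₂ _+_ (one d₄) (+-identityʳ y₂)
    two true  = trans (cong (y₂ +_) (trans (+-identityʳ _) (one d₄))) (+-comm y₂ _)
    three : ∀ d → ∑[ b′ ∈ bools ] ∑[ a ∈ bools ] ∑[ a′ ∈ bools ] pick d b′ (pick d₃ a (pick d₄ a′ x y) y) y ≡ (x + y) + y₂ + y₄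
    three false = cong₂ _+_ (two d₃) (+-identityʳ y₄)
    three true  = trans (cong (y₄ +_) (trans (+-identityʳ _) (two d₃))) (+-comm y₄ _)
    four : ∀ d → ∑[ b ∈ bools ] ∑[ b′ ∈ bools ] ∑[ a ∈ bools ] ∑[ a′ ∈ bools ]
      pick d b (pick d₂ b′ (pick d₃ a (pick d₄ a′ x y) y) y) y ≡ (x + y) + y₂ + y₄ + y₈
    four false = cong₂ _+_ (three d₂) (+-identityʳ y₈)
    four true  = trans (cong (y₈ +_) (trans (+-identityʳ _) (three d₂))) (+-comm y₈ _)

  -- Summing a function of four dot products over all weights.

  gate : Bool → Bool → ℕ → ℕ
  gate a b t = if a ∧ b then t else 0

  gate-zero : ∀ a b → gate a b 0 ≡ 0
  gate-zero false b     = refl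
  gate-zero true  false = refl
  gate-zero true  true  = refl

  dot : ∀ {M n} → Vec (Fin M) n → Vec Bool n → Vec Bool n → ℕ
  dot []      []      []      = 0
  dot (t ∷ w) (a ∷ u) (b ∷ v) = gate a b (toℕ t) ℕ.+ dot w u v

  Function⁴ : Set
  Function⁴ = ℕ → ℕ → ℕ → ℕ → ℚ

  module Smoothing (M : ℕ) .{{_ : ℕ.NonZero M}} where

    private m = ι M

    -- The effect of one coordinate of weight `t`: the arguments `p`, `q`, `r`, `s` stand for the
    -- dot products of (u, v), (u, v′), (u′, v) and (u′, v′).
    shift : Pattern → ℕ → Function⁴ → Function⁴
    shift (b , b′ , a , a′) t Φ p q r s = Φ (gate a b t ℕ.+ p) (gate a b′ t ℕ.+ q) (gate a′ b t ℕ.+ r) (gate a′ b′ t ℕ.+ s)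

    smooth : Pattern → Function⁴ → Function⁴
    smooth d Φ p q r s = ∑[ t ∈ allFin M ] shift d (toℕ t) Φ p q r s

    -- The gain is recorded here. A pointwise bound K alone would give K times a power of `M` after
    -- these summations; the definition asks for K itself.
    Bounded : List Pattern → ℚ → Function⁴ → Set
    Bounded []       K Φ = ∀ p q r s → Φ p q r s ≤ K
    Bounded (d ∷ ds) K Φ = Bounded ds K (smooth d Φ)

    bounded-mono : ∀ ds {K Φ Ψ} → (∀ p q r s → Φ p q r s ≤ Ψ p q r s) → Bounded ds K Ψ → Bounded ds K Φ
    bounded-mono []       Φ≤Ψ h p q r s = ≤-trans (Φ≤Ψ p q r s) (h p q r s)
    bounded-mono (d ∷ ds) Φ≤Ψ h = bounded-mono ds (λ p q r s → ∑-mono (allFin M) (λ t → Φ≤Ψ _ _ _ _)) h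

    shift-comm : ∀ Φ d t e t′ p q r s → shift e t′ (shift d t Φ) p q r s ≡ shift d t (shift e t′ Φ) p q r s
    shift-comm Φ (b , b′ , a , a′) t (c , c′ , f , f′) t′ p q r s
      rewrite x∙yz≈y∙xz (gate a b t) (gate f c t′) p | x∙yz≈y∙xz (gate a b′ t) (gate f c′ t′) q
            | x∙yz≈y∙xz (gate a′ b t) (gate f′ c t′) r | x∙yz≈y∙xz (gate a′ b′ t) (gate f′ c′ t′) s = refl

    -- For coordinates that do not show the awaited pattern: their weight translates the arguments,
    -- and `Bounded` is uniform in the arguments.
    bounded-shift : ∀ ds {K} Φ d t → Bounded ds K Φ → Bounded ds K (shift d t Φ)
    bounded-shift []       Φ d t h p q r s = h _ _ _ _
    bounded-shift (e ∷ ds) Φ d t h = bounded-mono ds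
      (λ p q r s → ≤-reflexive (∑-cong (allFin M) (λ t′ → shift-comm Φ d t e (toℕ t′) p q r s)))
      (bounded-shift ds (smooth e Φ) d t h)

    -- For vectors that end while patterns are still awaited. A sum of nonnegative terms dominates
    -- its term at weight 0, and weight 0 moves no argument.
    bounded-pointwise : ∀ ds {K} Φ → (∀ p q r s → 0ℚ ≤ Φ p q r s) → Bounded ds K Φ → ∀ p q r s → Φ p q r s ≤ K
    bounded-pointwise []       Φ 0≤Φ h = h
    bounded-pointwise (d@(b , b′ , a , a′) ∷ ds) Φ 0≤Φ h p q r s = ≤-trans
      (subst (_≤ smooth d Φ p q r s) at-zero (∑-range-head M (λ t → shift d t Φ p q r s) (λ t → 0≤Φ _ _ _ _)))
      (bounded-pointwise ds (smooth d Φ) (λ p q r s → ∑-nonNeg (allFin M) (λ t → 0≤Φ _ _ _ _)) h p q r s)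
      where
      at-zero : shift d 0 Φ p q r s ≡ Φ p q r s
      at-zero rewrite gate-zero a b | gate-zero a b′ | gate-zero a′ b | gate-zero a′ b′ = refl

    weightSum : ∀ {n} → Function⁴ → (u u′ v v′ : Vec Bool n) → ℚ
    weightSum {n} Φ u u′ v v′ = ∑[ w ∈ vecs (allFin M) n ] Φ (dot w u v) (dot w u v′) (dot w u′ v) (dot w u′ v′)

    weightSum-cons : ∀ {n} Φ a a′ b b′ (u u′ v v′ : Vec Bool n) →
      weightSum Φ (a ∷ u) (a′ ∷ u′) (b ∷ v) (b′ ∷ v′) ≡
      ∑[ t ∈ allFin M ] weightSum (shift (b , b′ , a , a′) (toℕ t) Φ) u u′ v v′
    weightSum-cons {n} Φ a a′ b b′ u u′ v v′ = ∑-vecs (allFin M) n _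

    weightSum-smooth : ∀ {n} d Φ (u u′ v v′ : Vec Bool n) →
      ∑[ t ∈ allFin M ] weightSum (shift d (toℕ t) Φ) u u′ v v′ ≡ weightSum (smooth d Φ) u u′ v v′
    weightSum-smooth {n} d Φ u u′ v v′ = ∑-swap (allFin M) (vecs (allFin M) n) _

    -- Every coordinate contributes a factor M, except those at which the next awaited pattern of ds occurs.
    patternBound : ∀ {n} → List Pattern → (u u′ v v′ : Vec Bool n) → ℚ
    patternBound ds       []      []        []      []        = 1ℚ
    patternBound []       (_ ∷ u) (_ ∷ u′)  (_ ∷ v) (_ ∷ v′)  = m * patternBound [] u u′ v v′
    patternBound (d ∷ ds) (a ∷ u) (a′ ∷ u′) (b ∷ v) (b′ ∷ v′) =
      select d (b , b′ , a , a′) (patternBound ds u u′ v v′) (m * patternBound (d ∷ ds) u u′ v v′)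

    -- Patterns are matched greedily along the vector. At a match the sum over the weight is
    -- absorbed into `smooth`, without a factor `M`; elsewhere it is a sum of `M` translates, each
    -- obeying the same bound.
    weightSum-≤ : ∀ {n} ds K Φ → (∀ p q r s → 0ℚ ≤ Φ p q r s) → Bounded ds K Φ → (u u′ v v′ : Vec Bool n) →
      weightSum Φ u u′ v v′ ≤ K * patternBound ds u u′ v v′
    weightSum-≤ ds K Φ 0≤Φ h [] [] [] [] = subst₂ _≤_ (sym (+-identityʳ (Φ 0 0 0 0))) (sym (*-identityʳ K))
      (bounded-pointwise ds Φ 0≤Φ h 0 0 0 0)
    weightSum-≤ [] K Φ 0≤Φ h (a ∷ u) (a′ ∷ u′) (b ∷ v) (b′ ∷ v′) = begin
      weightSum Φ (a ∷ u) (a′ ∷ u′) (b ∷ v) (b′ ∷ v′)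
        ≡⟨ weightSum-cons Φ a a′ b b′ u u′ v v′ ⟩
      ∑[ t ∈ allFin M ] weightSum (shift (b , b′ , a , a′) (toℕ t) Φ) u u′ v v′
        ≤⟨ ∑-mono (allFin M) (λ t → weightSum-≤ [] K (shift (b , b′ , a , a′) (toℕ t) Φ) (λ _ _ _ _ → 0≤Φ _ _ _ _) (λ _ _ _ _ → h _ _ _ _) u u′ v v′) ⟩
      ∑[ t ∈ allFin M ] (K * patternBound [] u u′ v v′)
        ≡⟨ ∑-range-const M _ ⟩
      m * (K * patternBound [] u u′ v v′)
        ≡⟨ solve 3 (λ m k w → m :* (k :* w) := k :* (m :* w)) refl m K (patternBound [] u u′ v v′) ⟩
      K * (m * patternBound [] u u′ v v′) ∎
      where open ≤-Reasoning
    weightSum-≤ (d ∷ ds) K Φ 0≤Φ h (a ∷ u) (a′ ∷ u′) (b ∷ v) (b′ ∷ v′) =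
      subst (_≤ K * patternBound (d ∷ ds) (a ∷ u) (a′ ∷ u′) (b ∷ v) (b′ ∷ v′)) (sym (weightSum-cons Φ a a′ b b′ u u′ v v′))
        (select-elim (λ W → ∑[ t ∈ allFin M ] weightSum (shift pat (toℕ t) Φ) u u′ v v′ ≤ K * W) d pat matched unmatched)
      where
      open ≤-Reasoning
      pat = (b , b′ , a , a′)
      matched : d ≡ pat → ∑[ t ∈ allFin M ] weightSum (shift pat (toℕ t) Φ) u u′ v v′ ≤ K * patternBound ds u u′ v v′
      matched refl = subst (_≤ K * patternBound ds u u′ v v′) (sym (weightSum-smooth pat Φ u u′ v v′))
        (weightSum-≤ ds K (smooth d Φ) (λ p q r s → ∑-nonNeg (allFin M) (λ t → 0≤Φ _ _ _ _)) h u u′ v v′)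
      unmatched : ∑[ t ∈ allFin M ] weightSum (shift pat (toℕ t) Φ) u u′ v v′ ≤ K * (m * patternBound (d ∷ ds) u u′ v v′)
      unmatched = begin
        ∑[ t ∈ allFin M ] weightSum (shift pat (toℕ t) Φ) u u′ v v′
          ≤⟨ ∑-mono (allFin M) (λ t → weightSum-≤ (d ∷ ds) K (shift pat (toℕ t) Φ) (λ _ _ _ _ → 0≤Φ _ _ _ _)
               (bounded-shift (d ∷ ds) Φ pat (toℕ t) h) u u′ v v′) ⟩
        ∑[ t ∈ allFin M ] (K * patternBound (d ∷ ds) u u′ v v′)
          ≡⟨ ∑-range-const M _ ⟩
        m * (K * patternBound (d ∷ ds) u u′ v v′)
          ≡⟨ solve 3 (λ m k w → m :* (k :* w) := k :* (m :* w)) refl m K (patternBound (d ∷ ds) u u′ v v′) ⟩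
        K * (m * patternBound (d ∷ ds) u u′ v v′) ∎

    abs : Function⁴ → Function⁴
    abs Φ p q r s = ∣ Φ p q r s ∣

    -- Until the pattern d occurs nothing is gained; when it occurs, the sum over that weight is
    -- performed inside the absolute value, so that it may telescope.
    weightSum-telescope : ∀ {n} d ds K Φ → Bounded ds K (abs Φ) → Bounded ds K (abs (smooth d Φ)) →
      (u u′ v v′ : Vec Bool n) → ∣ weightSum Φ u u′ v v′ ∣ ≤ K * patternBound (d ∷ ds) u u′ v v′
    weightSum-telescope d ds K Φ h hs [] [] [] [] = subst₂ _≤_ (cong ∣_∣ (sym (+-identityʳ (Φ 0 0 0 0)))) (sym (*-identityʳ K))
      (bounded-pointwise ds (abs Φ) (λ p q r s → 0≤∣p∣ (Φ p q r s)) h 0 0 0 0)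
    weightSum-telescope {suc n} d ds K Φ h hs (a ∷ u) (a′ ∷ u′) (b ∷ v) (b′ ∷ v′) =
      subst (λ E → ∣ E ∣ ≤ K * patternBound (d ∷ ds) (a ∷ u) (a′ ∷ u′) (b ∷ v) (b′ ∷ v′)) (sym (weightSum-cons Φ a a′ b b′ u u′ v v′))
        (select-elim (λ W → ∣ (∑[ t ∈ allFin M ] weightSum (shift pat (toℕ t) Φ) u u′ v v′) ∣ ≤ K * W) d pat matched unmatched)
      where
      open ≤-Reasoning
      pat = (b , b′ , a , a′)
      matched : d ≡ pat → ∣ (∑[ t ∈ allFin M ] weightSum (shift pat (toℕ t) Φ) u u′ v v′) ∣ ≤ K * patternBound ds u u′ v v′
      matched refl = begin
        ∣ (∑[ t ∈ allFin M ] weightSum (shift pat (toℕ t) Φ) u u′ v v′) ∣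
          ≡⟨ cong ∣_∣ (weightSum-smooth pat Φ u u′ v v′) ⟩
        ∣ weightSum (smooth pat Φ) u u′ v v′ ∣
          ≤⟨ ∑-∣∣ (vecs (allFin M) n) _ ⟩
        weightSum (abs (smooth pat Φ)) u u′ v v′
          ≤⟨ weightSum-≤ ds K (abs (smooth pat Φ)) (λ p q r s → 0≤∣p∣ (smooth pat Φ p q r s)) hs u u′ v v′ ⟩
        K * patternBound ds u u′ v v′ ∎
      unmatched : ∣ (∑[ t ∈ allFin M ] weightSum (shift pat (toℕ t) Φ) u u′ v v′) ∣ ≤ K * (m * patternBound (d ∷ ds) u u′ v v′)
      unmatched = begin
        ∣ (∑[ t ∈ allFin M ] weightSum (shift pat (toℕ t) Φ) u u′ v v′) ∣
          ≤⟨ ∑-∣∣ (allFin M) _ ⟩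
        ∑[ t ∈ allFin M ] ∣ weightSum (shift pat (toℕ t) Φ) u u′ v v′ ∣
          ≤⟨ ∑-mono (allFin M) (λ t → weightSum-telescope d ds K (shift pat (toℕ t) Φ)
               (bounded-shift ds (abs Φ) pat (toℕ t) h)
               (bounded-mono ds (λ p q r s → ≤-reflexive (cong ∣_∣ (∑-cong (allFin M) (λ t′ → shift-comm Φ pat (toℕ t) d (toℕ t′) p q r s))))
                  (bounded-shift ds (abs (smooth d Φ)) pat (toℕ t) hs)) u u′ v v′) ⟩
        ∑[ t ∈ allFin M ] (K * patternBound (d ∷ ds) u u′ v v′)
          ≡⟨ ∑-range-const M _ ⟩
        m * (K * patternBound (d ∷ ds) u u′ v v′)
          ≡⟨ solve 3 (λ m k w → m :* (k :* w) := k :* (m :* w)) refl m K (patternBound (d ∷ ds) u u′ v v′) ⟩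
        K * (m * patternBound (d ∷ ds) u u′ v v′) ∎

  -- The box sum over all weights and the mass over all thresholds.

  ^-nonNeg : 0ℚ ≤ x → ∀ n → 0ℚ ≤ x ^ℚ n
  ^-nonNeg 0≤x zero    = 0≤1
  ^-nonNeg 0≤x (suc n) = *-nonNeg 0≤x (^-nonNeg 0≤x n)

  ^-distribʳ-* : ∀ x y n → (x * y) ^ℚ n ≡ (x ^ℚ n) * (y ^ℚ n)
  ^-distribʳ-* x y zero    = refl
  ^-distribʳ-* x y (suc n) = trans (cong ((x * y) *_) (^-distribʳ-* x y n))
    (solve 4 (λ x y p q → (x :* y) :* (p :* q) := (x :* p) :* (y :* q)) refl x y (x ^ℚ n) (y ^ℚ n))

  ι-^ : ∀ a n → ι (a ℕ.^ n) ≡ ι a ^ℚ n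
  ι-^ a zero    = refl
  ι-^ a (suc n) = trans (ι-* a (a ℕ.^ n)) (cong (ι a *_) (ι-^ a n))

  jump-telescope : ∀ n θ x → ∑[ t ∈ allFin n ] jump θ (toℕ t ℕ.+ x) ≡ δ x θ - δ (n ℕ.+ x) θ
  jump-telescope zero    θ x = sym (+-inverseʳ (δ x θ))
  jump-telescope (suc n) θ x = begin
    ∑[ t ∈ allFin (suc n) ] jump θ (toℕ t ℕ.+ x)
      ≡⟨ ∑-allFin n (λ t → jump θ (toℕ t ℕ.+ x)) ⟩
    jump θ x + (∑[ t ∈ allFin n ] jump θ (suc (toℕ t ℕ.+ x)))
      ≡⟨ cong (jump θ x +_) (trans (∑-cong (allFin n) (λ t → cong (jump θ) (sym (ℕₚ.+-suc (toℕ t) x)))) (jump-telescope n θ (suc x))) ⟩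
    jump θ x + (δ (suc x) θ - δ (n ℕ.+ suc x) θ)
      ≡⟨ cong (λ e → jump θ x + (δ (suc x) θ - δ e θ)) (ℕₚ.+-suc n x) ⟩
    (δ x θ - δ (suc x) θ) + (δ (suc x) θ - δ (suc n ℕ.+ x) θ)
      ≡⟨ solve 3 (λ a b c → (a :- b) :+ (b :- c) := a :- c) refl (δ x θ) (δ (suc x) θ) (δ (suc n ℕ.+ x) θ) ⟩
    δ x θ - δ (suc n ℕ.+ x) θ ∎
    where open ≡-Reasoning

  δ≤∣jump∣ : ∀ s θ → δ s θ ≤ ∣ jump θ s ∣
  δ≤∣jump∣ zero    zero    = ≤-refl
  δ≤∣jump∣ zero    (suc θ) = 0≤∣p∣ (jump (suc θ) zero)
  δ≤∣jump∣ (suc s) zero    = 0≤∣p∣ (jump zero (suc s))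
  δ≤∣jump∣ (suc s) (suc θ) = δ≤∣jump∣ s θ

  jump-nonNeg : ∀ s θ → (s ℕ.<ᵇ θ) ≡ false → 0ℚ ≤ jump θ s
  jump-nonNeg zero    zero    _ = 0≤1
  jump-nonNeg (suc s) zero    _ = ≤-refl
  jump-nonNeg (suc s) (suc θ) h = jump-nonNeg s θ h

  jump-nonPos : ∀ s θ → (s ℕ.<ᵇ θ) ≡ true → jump θ s ≤ 0ℚ
  jump-nonPos zero    (suc θ) _ = subst (_≤ 0ℚ) (sym (+-identityˡ _)) (neg-antimono-≤ (0≤δ zero θ))
  jump-nonPos (suc s) (suc θ) h = jump-nonPos s θ h

  gate-≤ : ∀ a b t → gate a b t ℕ.≤ t
  gate-≤ false b     t = ℕ.z≤n
  gate-≤ true  false t = ℕ.z≤n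
  gate-≤ true  true  t = ℕₚ.≤-refl

  dot-≤ : ∀ {M n} (w : Vec (Fin M) n) u v → dot w u v ℕ.≤ n ℕ.* M
  dot-≤ []      []      []      = ℕ.z≤n
  dot-≤ (t ∷ w) (a ∷ u) (b ∷ v) = ℕₚ.+-mono-≤ (ℕₚ.≤-trans (gate-≤ a b (toℕ t)) (ℕₚ.<⇒≤ (Finₚ.toℕ<n t))) (dot-≤ w u v)

  module Counting (M : ℕ) .{{_ : ℕ.NonZero M}} where
    open Smoothing M
    private m = ι M

    total : List Pattern → ℕ → ℚ
    total ds n = ∑⁴ n (patternBound ds)

    select-∑⁴ : ∀ n d p f g → ∑⁴ n (λ u u′ v v′ → select d p (f u u′ v v′) (g u u′ v v′)) ≡ select d p (∑⁴ n f) (∑⁴ n g)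
    select-∑⁴ n (d₁ , d₂ , d₃ , d₄) (b , b′ , a , a′) f g =
      trans (pick-∑⁴ d₁ b _) (cong (λ s → pick d₁ b s G) (
      trans (pick-∑⁴ d₂ b′ _) (cong (λ s → pick d₂ b′ s G) (
      trans (pick-∑⁴ d₃ a _) (cong (λ s → pick d₃ a s G) (
      pick-∑⁴ d₄ a′ f))))))
      where
      G = ∑⁴ n g
      pick-∑⁴ : ∀ d b f → ∑⁴ n (λ u u′ v v′ → pick d b (f u u′ v v′) (g u u′ v v′)) ≡ pick d b (∑⁴ n f) G
      pick-∑⁴ false false f = refl
      pick-∑⁴ false true  f = refl
      pick-∑⁴ true  false f = refl
      pick-∑⁴ true  true  f = refl

    total-nil : ∀ n → total [] (suc n) ≡ ι 16 * (m * total [] n)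
    total-nil n = begin
      total [] (suc n)
        ≡⟨ ∑⁴-suc n (patternBound []) ⟩
      ∑[ b ∈ bools ] ∑[ b′ ∈ bools ] ∑[ a ∈ bools ] ∑[ a′ ∈ bools ] ∑⁴ n (λ u u′ v v′ → m * patternBound [] u u′ v v′)
        ≡⟨ ∑-cong bools (λ b → ∑-cong bools (λ b′ → ∑-cong bools (λ a → ∑-cong bools (λ a′ → ∑⁴-*ˡ n m (patternBound []))))) ⟩
      ∑[ b ∈ bools ] ∑[ b′ ∈ bools ] ∑[ a ∈ bools ] ∑[ a′ ∈ bools ] (m * total [] n)
        ≡⟨ solve 1 (λ y → let y₂ = y :+ (y :+ con 0ℚ) ; y₄ = y₂ :+ (y₂ :+ con 0ℚ) ; y₈ = y₄ :+ (y₄ :+ con 0ℚ) in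
             y₈ :+ (y₈ :+ con 0ℚ) := con (ι 16) :* y) refl (m * total [] n) ⟩
      ι 16 * (m * total [] n) ∎
      where open ≡-Reasoning

    total-cons : ∀ d ds n → total (d ∷ ds) (suc n) ≡ total ds n + ι 15 * (m * total (d ∷ ds) n)
    total-cons d ds n = begin
      total (d ∷ ds) (suc n)
        ≡⟨ ∑⁴-suc n (patternBound (d ∷ ds)) ⟩
      ∑[ b ∈ bools ] ∑[ b′ ∈ bools ] ∑[ a ∈ bools ] ∑[ a′ ∈ bools ]
        ∑⁴ n (λ u u′ v v′ → select d (b , b′ , a , a′) (patternBound ds u u′ v v′) (m * patternBound (d ∷ ds) u u′ v v′))
        ≡⟨ ∑-cong bools (λ b → ∑-cong bools (λ b′ → ∑-cong bools (λ a → ∑-cong bools (λ a′ →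
             trans (select-∑⁴ n d (b , b′ , a , a′) (patternBound ds) (λ u u′ v v′ → m * patternBound (d ∷ ds) u u′ v v′))
               (cong (select d (b , b′ , a , a′) (total ds n)) (∑⁴-*ˡ n m (patternBound (d ∷ ds)))))))) ⟩
      ∑[ b ∈ bools ] ∑[ b′ ∈ bools ] ∑[ a ∈ bools ] ∑[ a′ ∈ bools ]
        select d (b , b′ , a , a′) (total ds n) (m * total (d ∷ ds) n)
        ≡⟨ ∑-select d (total ds n) (m * total (d ∷ ds) n) ⟩
      total ds n + ι 15 * (m * total (d ∷ ds) n) ∎
      where open ≡-Reasoning

    -- The extra factor 2 per coordinate turns the counts 16 and 15 of patterns into 32 and 30, so
    -- that an integer base fits strictly between them.
    total-[] : ∀ n → (ι 2 ^ℚ n) * total [] n ≡ (ι 32 * m) ^ℚ n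
    total-[] zero    = refl
    total-[] (suc n) = begin
      (ι 2 * (ι 2 ^ℚ n)) * total [] (suc n)           ≡⟨ cong ((ι 2 * (ι 2 ^ℚ n)) *_) (total-nil n) ⟩
      (ι 2 * (ι 2 ^ℚ n)) * (ι 16 * (m * total [] n))  ≡⟨ solve 3 (λ p m t → (con (ι 2) :* p) :* (con (ι 16) :* (m :* t)) := (con (ι 32) :* m) :* (p :* t)) refl (ι 2 ^ℚ n) m (total [] n) ⟩
      (ι 32 * m) * ((ι 2 ^ℚ n) * total [] n)          ≡⟨ cong ((ι 32 * m) *_) (total-[] n) ⟩
      (ι 32 * m) * ((ι 32 * m) ^ℚ n)                  ∎
      where open ≡-Reasoning

    -- The second summand accounts for the quadruples in which the patterns ds do not all occur;
    -- 31 rather than 30 leaves room to absorb the contributions of shorter lists.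
    total-≤ : 2 ℕ.≤ M → ∀ ds n →
      ((ι 2 ^ℚ n) * (m ^ℚ length ds)) * total ds n ≤ ((ι 32 * m) ^ℚ n) + (m ^ℚ length ds) * ((ι 31 * m) ^ℚ n)
    total-≤ 2≤M [] n = subst₂ _≤_
      (trans (+-identityʳ _) (trans (sym (total-[] n)) (cong (_* total [] n) (sym (*-identityʳ (ι 2 ^ℚ n))))))
      (cong (((ι 32 * m) ^ℚ n) +_) (sym (*-identityˡ _)))
      (+-monoʳ-≤ ((ι 32 * m) ^ℚ n) (^-nonNeg (*-nonNeg (0≤ι 31) (0≤ι M)) n))
    total-≤ 2≤M (d ∷ ds) zero = subst₂ _≤_
      (solve 1 (λ p → con 0ℚ :+ p := (con 1ℚ :* p) :* con 1ℚ) refl (m ^ℚ length (d ∷ ds)))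
      (solve 1 (λ p → con 1ℚ :+ p := con 1ℚ :+ p :* con 1ℚ) refl (m ^ℚ length (d ∷ ds)))
      (+-monoˡ-≤ (m ^ℚ length (d ∷ ds)) 0≤1)
    total-≤ 2≤M (d ∷ ds) (suc n) = begin
      ((ι 2 * P) * (m * L)) * total (d ∷ ds) (suc n)
        ≡⟨ cong (((ι 2 * P) * (m * L)) *_) (total-cons d ds n) ⟩
      ((ι 2 * P) * (m * L)) * (T + ι 15 * (m * T′))
        ≡⟨ solve 5 (λ p m l t t′ → ((con (ι 2) :* p) :* (m :* l)) :* (t :+ con (ι 15) :* (m :* t′))
             := (con (ι 2) :* m) :* ((p :* l) :* t) :+ (con (ι 30) :* m) :* ((p :* (m :* l)) :* t′)) refl P m L T T′ ⟩
      (ι 2 * m) * ((P * L) * T) + (ι 30 * m) * ((P * (m * L)) * T′)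
        ≤⟨ +-mono-≤ (*-monoˡ-≤′ (*-nonNeg (0≤ι 2) (0≤ι M)) (total-≤ 2≤M ds n))
                    (*-monoˡ-≤′ (*-nonNeg (0≤ι 30) (0≤ι M)) (total-≤ 2≤M (d ∷ ds) n)) ⟩
      (ι 2 * m) * (U + L * V) + (ι 30 * m) * (U + (m * L) * V)
        ≡⟨ solve 4 (λ m u l v → (con (ι 2) :* m) :* (u :+ l :* v) :+ (con (ι 30) :* m) :* (u :+ (m :* l) :* v)
             := ((con (ι 32) :* m) :* u) :+ (m :* (l :* v)) :* (con (ι 2) :+ con (ι 30) :* m)) refl m U L V ⟩
      ((ι 32 * m) * U) + (m * (L * V)) * (ι 2 + ι 30 * m)
        ≤⟨ +-monoʳ-≤ ((ι 32 * m) * U) (*-monoˡ-≤′ (*-nonNeg (0≤ι M) (*-nonNeg (^-nonNeg (0≤ι M) (length ds)) (^-nonNeg (*-nonNeg (0≤ι 31) (0≤ι M)) n)))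
             (+-monoˡ-≤ (ι 30 * m) (ι-mono 2≤M))) ⟩
      ((ι 32 * m) * U) + (m * (L * V)) * (m + ι 30 * m)
        ≡⟨ solve 4 (λ m u l v → ((con (ι 32) :* m) :* u) :+ (m :* (l :* v)) :* (m :+ con (ι 30) :* m)
             := ((con (ι 32) :* m) :* u) :+ (m :* l) :* ((con (ι 31) :* m) :* v)) refl m U L V ⟩
      ((ι 32 * m) * U) + (m * L) * ((ι 31 * m) * V) ∎
      where
      open ≤-Reasoning
      P = ι 2 ^ℚ n
      L = m ^ℚ length ds
      T = total ds n
      T′ = total (d ∷ ds) n
      U = (ι 32 * m) ^ℚ n
      V = (ι 31 * m) ^ℚ n

    -- The value 2 allows for two point masses, and its fourth power is the constant 16 below.
    Sparse : (ℕ → ℚ) → Set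
    Sparse g = ∀ x → ∑[ t ∈ allFin M ] ∣ g (toℕ t ℕ.+ x) ∣ ≤ ι 2

    product⁴ : (g₁ g₂ g₃ g₄ : ℕ → ℚ) → Function⁴
    product⁴ g₁ g₂ g₃ g₄ p q r s = (g₁ p * g₂ q) * (g₃ r * g₄ s)

    -- The patterns in which exactly one of the four dot products sees the weight.
    direction₁ : Pattern
    direction₁ = true , false , true , false

    directions : List Pattern
    directions = direction₁ ∷ (false , true , true , false) ∷ (true , false , false , true) ∷ (false , true , false , true) ∷ []

    -- Each direction moves exactly one of the four arguments, so the fourfold sum over weights
    -- factors into four window sums.
    bounded-product⁴ : ∀ {g₁ g₂ g₃ g₄} → Sparse g₁ → Sparse g₂ → Sparse g₃ → Sparse g₄ →
      Bounded directions (ι 16) (abs (product⁴ g₁ g₂ g₃ g₄))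
    bounded-product⁴ {g₁} {g₂} {g₃} {g₄} s₁ s₂ s₃ s₄ p q r s = subst (_≤ ι 16) (sym factor)
      (*-mono-≤-nonNeg (*-nonNeg (0≤S g₁ p) (0≤S g₂ q)) (*-mono-≤-nonNeg (0≤S g₁ p) (s₁ p) (0≤S g₂ q) (s₂ q))
                       (*-nonNeg (0≤S g₃ r) (0≤S g₄ s)) (*-mono-≤-nonNeg (0≤S g₃ r) (s₃ r) (0≤S g₄ s) (s₄ s)))
      where
      F = allFin M
      S : (ℕ → ℚ) → ℕ → ℚ
      S g x = ∑[ t ∈ F ] ∣ g (toℕ t ℕ.+ x) ∣
      0≤S : ∀ g x → 0ℚ ≤ S g x
      0≤S g x = ∑-nonNeg F (λ t → 0≤∣p∣ (g (toℕ t ℕ.+ x)))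
      abs-product : ∀ a b c d → ∣ (a * b) * (c * d) ∣ ≡ ∣ a ∣ * (∣ b ∣ * (∣ c ∣ * ∣ d ∣))
      abs-product a b c d = trans (∣p*q∣≡∣p∣*∣q∣ (a * b) (c * d))
        (trans (cong₂ _*_ (∣p*q∣≡∣p∣*∣q∣ a b) (∣p*q∣≡∣p∣*∣q∣ c d)) (*-assoc (∣ a ∣) (∣ b ∣) (∣ c ∣ * ∣ d ∣)))
      factor : smooth (false , true , false , true) (smooth (true , false , false , true) (smooth (false , true , true , false)
        (smooth direction₁ (abs (product⁴ g₁ g₂ g₃ g₄))))) p q r s ≡ (S g₁ p * S g₂ q) * (S g₃ r * S g₄ s)
      factor = trans (∑-cong F (λ t₄ → trans (∑-cong F (λ t₃ → trans (∑-cong F (λ t₂ → trans (∑-cong F (λ t₁ →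
          abs-product (g₁ (toℕ t₁ ℕ.+ p)) (g₂ (toℕ t₂ ℕ.+ q)) (g₃ (toℕ t₃ ℕ.+ r)) (g₄ (toℕ t₄ ℕ.+ s))))
          (∑-*ʳ F _ _))) (trans (∑-*ˡ F (S g₁ p) _) (cong (S g₁ p *_) (∑-*ʳ F _ _)))))
          (trans (∑-*ˡ F (S g₁ p) _) (cong (S g₁ p *_) (trans (∑-*ˡ F (S g₂ q) _) (cong (S g₂ q *_) (∑-*ʳ F _ _)))))))
          (trans (∑-*ˡ F (S g₁ p) _) (trans (cong (S g₁ p *_) (trans (∑-*ˡ F (S g₂ q) _) (cong (S g₂ q *_) (∑-*ˡ F (S g₃ r) _))))
            (sym (*-assoc (S g₁ p) (S g₂ q) (S g₃ r * S g₄ s)))))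

    -- Stated for every `c` because it serves twice: `c` = 1 is `jump` itself and `c` = `M` is a
    -- telescoped sum of jumps.
    δ-difference-sparse : ∀ θ c → Sparse (λ x → δ x θ - δ (c ℕ.+ x) θ)
    δ-difference-sparse θ c x = begin
      ∑[ t ∈ allFin M ] ∣ δ (toℕ t ℕ.+ x) θ - δ (c ℕ.+ (toℕ t ℕ.+ x)) θ ∣
        ≤⟨ ∑-mono (allFin M) (λ t → ≤-trans (∣p-q∣≤∣p∣+∣q∣ (δ (toℕ t ℕ.+ x) θ) (δ (c ℕ.+ (toℕ t ℕ.+ x)) θ))
             (≤-reflexive (cong₂ _+_ (0≤p⇒∣p∣≡p (0≤δ (toℕ t ℕ.+ x) θ)) (trans (0≤p⇒∣p∣≡p (0≤δ (c ℕ.+ (toℕ t ℕ.+ x)) θ))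
                (cong (λ e → δ e θ) (x∙yz≈y∙xz c (toℕ t) x)))))) ⟩
      ∑[ t ∈ allFin M ] (δ (toℕ t ℕ.+ x) θ + δ (toℕ t ℕ.+ (c ℕ.+ x)) θ)
        ≡⟨ ∑-distrib-+ (allFin M) (λ t → δ (toℕ t ℕ.+ x) θ) (λ t → δ (toℕ t ℕ.+ (c ℕ.+ x)) θ) ⟩
      (∑[ t ∈ allFin M ] δ (toℕ t ℕ.+ x) θ) + (∑[ t ∈ allFin M ] δ (toℕ t ℕ.+ (c ℕ.+ x)) θ)
        ≤⟨ +-mono-≤ (∑-δ≤1 M x θ) (∑-δ≤1 M (c ℕ.+ x) θ) ⟩
      1ℚ + 1ℚ ∎
      where
      open ≤-Reasoning

    tensor : ℕ → Function⁴
    tensor θ = product⁴ (jump θ) (jump θ) (jump θ) (jump θ)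

    tensor-bounded : ∀ θ → Bounded directions (ι 16) (abs (tensor θ))
    tensor-bounded θ = bounded-product⁴ {jump θ} {jump θ} {jump θ} {jump θ} sparse sparse sparse sparse
      where sparse = δ-difference-sparse θ 1

    -- The source of the fifth factor `M`. Summing the first `jump` over a whole weight range leaves
    -- a difference of two point masses, as sparse as a single jump, so the bound 16 survives and
    -- `direction₁` can be used a second time.
    smooth-tensor-bounded : ∀ θ → Bounded directions (ι 16) (abs (smooth direction₁ (tensor θ)))
    smooth-tensor-bounded θ = bounded-mono directions
      (λ p q r s → ≤-reflexive (cong ∣_∣ (telescope p q r s)))
      (bounded-product⁴ {λ x → δ x θ - δ (M ℕ.+ x) θ} {jump θ} {jump θ} {jump θ} (δ-difference-sparse θ M) sparse sparse sparse)
      where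
      sparse = δ-difference-sparse θ 1
      telescope : ∀ p q r s → smooth direction₁ (tensor θ) p q r s ≡
        product⁴ (λ x → δ x θ - δ (M ℕ.+ x) θ) (jump θ) (jump θ) (jump θ) p q r s
      telescope p q r s = trans (∑-*ʳ (allFin M) (jump θ r * jump θ s) _) (cong (_* (jump θ r * jump θ s))
        (trans (∑-*ʳ (allFin M) (jump θ q) (λ t → jump θ (toℕ t ℕ.+ p))) (cong (_* jump θ q) (jump-telescope M θ p))))

    module Threshold {n} (w : Vec (Fin M) n) (θ : ℕ) =
      Discrepancy (cube n) (cube n) (λ u v → jump θ (dot w u v))

    weights : ∀ n → List (Vec (Fin M) n)
    weights n = vecs (allFin M) n

    box-expand : ∀ {n} (w : Vec (Fin M) n) θ → Threshold.box w θ ≡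
      ∑⁴ n (λ u u′ v v′ → tensor θ (dot w u v) (dot w u v′) (dot w u′ v) (dot w u′ v′))
    box-expand {n} w θ = ∑-cong (cube n) (λ v → ∑-cong (cube n) (λ v′ → ∑-product (cube n) (cube n) _ _))

    ∑-box-≤ : ∀ n θ → ∑[ w ∈ weights n ] Threshold.box w θ ≤ ι 16 * total (direction₁ ∷ directions) n
    ∑-box-≤ n θ = begin
      ∑[ w ∈ weights n ] Threshold.box w θ
        ≡⟨ ∑-cong (weights n) (λ w → box-expand w θ) ⟩
      ∑[ w ∈ weights n ] ∑⁴ n (λ u u′ v v′ → tensor θ (dot w u v) (dot w u v′) (dot w u′ v) (dot w u′ v′))
        ≡⟨ ∑-∑⁴-swap (weights n) n _ ⟩
      ∑⁴ n (weightSum (tensor θ))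
        ≤⟨ ∑⁴-mono n (λ u u′ v v′ → ≤-trans (x≤∣x∣ (weightSum (tensor θ) u u′ v v′))
             (weightSum-telescope direction₁ directions (ι 16) (tensor θ) (tensor-bounded θ) (smooth-tensor-bounded θ) u u′ v v′)) ⟩
      ∑⁴ n (λ u u′ v v′ → ι 16 * patternBound (direction₁ ∷ directions) u u′ v v′)
        ≡⟨ ∑⁴-*ˡ n (ι 16) (patternBound (direction₁ ∷ directions)) ⟩
      ι 16 * total (direction₁ ∷ directions) n ∎
      where open ≤-Reasoning

    count-cube : ∀ n c → ∑[ _ ∈ cube n ] c ≡ (ι 2 ^ℚ n) * c
    count-cube n c = trans (∑-const (cube n) c) (cong (_* c) (trans (cong ι (length-vecs bools n)) (ι-^ 2 n)))

    count-weights : ∀ n c → ∑[ _ ∈ weights n ] c ≡ (m ^ℚ n) * c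
    count-weights n c = trans (∑-const (weights n) c) (cong (_* c) (trans
      (cong ι (trans (length-vecs (allFin M) n) (cong (ℕ._^ n) (Listₚ.length-tabulate {n = M} id)))) (ι-^ M n)))

    -- Every pair has mass at the threshold equal to its dot product, and `R` is large enough for
    -- that threshold to be in range.
    ∑-mass-≥ : ∀ {n} R → n ℕ.* M ℕ.< R → (w : Vec (Fin M) n) →
      (ι 2 ^ℚ n) * (ι 2 ^ℚ n) ≤ ∑[ θ ∈ allFin R ] Threshold.mass w (toℕ θ)
    ∑-mass-≥ {n} R nM<R w = begin
      (ι 2 ^ℚ n) * (ι 2 ^ℚ n)
        ≡⟨ cong ((ι 2 ^ℚ n) *_) (sym (*-identityʳ (ι 2 ^ℚ n))) ⟩
      (ι 2 ^ℚ n) * ((ι 2 ^ℚ n) * 1ℚ)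
        ≡⟨ sym (trans (∑-cong (cube n) (λ _ → count-cube n 1ℚ)) (count-cube n ((ι 2 ^ℚ n) * 1ℚ))) ⟩
      ∑[ u ∈ cube n ] ∑[ v ∈ cube n ] 1ℚ
        ≡⟨ ∑-cong (cube n) (λ u → ∑-cong (cube n) (λ v → sym (∑-δ≡1 {R} (ℕₚ.≤-<-trans (dot-≤ w u v) nM<R)))) ⟩
      ∑[ u ∈ cube n ] ∑[ v ∈ cube n ] ∑[ θ ∈ allFin R ] δ (dot w u v) (toℕ θ)
        ≤⟨ ∑-mono (cube n) (λ u → ∑-mono (cube n) (λ v → ∑-mono (allFin R) (λ θ → δ≤∣jump∣ (dot w u v) (toℕ θ)))) ⟩
      ∑[ u ∈ cube n ] ∑[ v ∈ cube n ] ∑[ θ ∈ allFin R ] ∣ jump (toℕ θ) (dot w u v) ∣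
        ≡⟨ trans (∑-cong (cube n) (λ u → ∑-swap (cube n) (allFin R) _)) (∑-swap (cube n) (allFin R) _) ⟩
      ∑[ θ ∈ allFin R ] Threshold.mass w (toℕ θ) ∎
      where open ≤-Reasoning

  -- Choosing the weights and the threshold.

  threshold : ∀ {M n} → Vec (Fin M) n → ℕ → Vec Bool n → Vec Bool n → Bool
  threshold w θ u v = dot w u v ℕ.<ᵇ θ

  0<-* : 0ℚ < x → 0ℚ < y → 0ℚ < x * y
  0<-* {x} {y} 0<x 0<y = positive⁻¹ (x * y) {{pos*pos⇒pos x {{positive 0<x}} y {{positive 0<y}}}}

  *-cancelˡ-≤′ : 0ℚ < z → z * x ≤ z * y → x ≤ y
  *-cancelˡ-≤′ {z} 0<z = *-cancelˡ-≤-pos z {{positive 0<z}}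

  ^-pos : 0ℚ < x → ∀ n → 0ℚ < x ^ℚ n
  ^-pos 0<x zero    = positive⁻¹ 1ℚ
  ^-pos 0<x (suc n) = 0<-* 0<x (^-pos 0<x n)

  -- The hypotheses are those delivered by the choice of weights and by a protocol of cost c,
  -- with f = 4ⁿ, X the mass and C = 16ᶜ.
  advantage-from-choice : ∀ {f m₅ box r X C e} → 0ℚ < f → 0ℚ ≤ m₅ → 0ℚ ≤ box → 0ℚ < r → 0ℚ ≤ X → 0ℚ ≤ C →
    ι 32 * sq f + m₅ * box ≤ (ι 64 * (r * f)) * X →
    sq (sq ((e + e) * X)) ≤ C * (f * (f * box)) →
    sq (sq e) * m₅ ≤ ι 32 * (C * sq (sq r))
  advantage-from-choice {f} {m₅} {box} {r} {X} {C} {e} 0<f 0≤m₅ 0≤box 0<r 0≤X 0≤C choice protocol =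
    *-cancelˡ-≤′ (0<-* (ι-pos 16) (0<-* (0<-* 0<X 0<X) (0<-* 0<X 0<X))) (begin
      ι 16 * sq (sq X) * (sq (sq e) * m₅)
        ≡⟨ solve 3 (λ x e m → con (ι 16) :* ((x :* x) :* (x :* x)) :* (((e :* e) :* (e :* e)) :* m)
             := m :* ((((e :+ e) :* x) :* ((e :+ e) :* x)) :* (((e :+ e) :* x) :* ((e :+ e) :* x)))) refl X e m₅ ⟩
      m₅ * sq (sq ((e + e) * X))
        ≤⟨ *-monoˡ-≤′ 0≤m₅ protocol ⟩
      m₅ * (C * (f * (f * box)))
        ≡⟨ solve 4 (λ m c f b → m :* (c :* (f :* (f :* b))) := (c :* (f :* f)) :* (m :* b)) refl m₅ C f box ⟩
      (C * sq f) * (m₅ * box)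
        ≤⟨ *-monoˡ-≤′ (*-nonNeg 0≤C (0≤x² f)) box≤ ⟩
      (C * sq f) * ((ι 64 * (r * f)) * X)
        ≡⟨ solve 4 (λ c f r x → (c :* (f :* f)) :* ((con (ι 64) :* (r :* f)) :* x) := (con (ι 64) :* ((c :* r) :* x)) :* ((f :* f) :* f)) refl C f r X ⟩
      (ι 64 * ((C * r) * X)) * (sq f * f)
        ≤⟨ *-monoˡ-≤′ (*-nonNeg (0≤ι 64) (*-nonNeg (*-nonNeg 0≤C (<⇒≤ 0<r)) 0≤X))
             (*-mono-≤-nonNeg (0≤x² f) (sq-mono (<⇒≤ 0<f) f≤) (<⇒≤ 0<f) f≤) ⟩
      (ι 64 * ((C * r) * X)) * (sq (ι 2 * (r * X)) * (ι 2 * (r * X)))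
        ≡⟨ solve 3 (λ c r x → let y = con (ι 2) :* (r :* x) in
             (con (ι 64) :* ((c :* r) :* x)) :* ((y :* y) :* y)
             := con (ι 16) :* ((x :* x) :* (x :* x)) :* (con (ι 32) :* (c :* ((r :* r) :* (r :* r))))) refl C r X ⟩
      ι 16 * sq (sq X) * (ι 32 * (C * sq (sq r))) ∎)
    where
    open ≤-Reasoning
    box≤ : m₅ * box ≤ (ι 64 * (r * f)) * X
    box≤ = ≤-trans (subst (_≤ ι 32 * sq f + m₅ * box) (+-identityˡ (m₅ * box))
      (+-monoˡ-≤ (m₅ * box) (*-nonNeg (0≤ι 32) (0≤x² f)))) choice
    f≤ : f ≤ ι 2 * (r * X)
    f≤ = *-cancelˡ-≤′ (0<-* (ι-pos 32) 0<f) (begin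
      ι 32 * f * f                    ≡⟨ *-assoc (ι 32) f f ⟩
      ι 32 * sq f                     ≡⟨ sym (+-identityʳ (ι 32 * sq f)) ⟩
      ι 32 * sq f + 0ℚ                ≤⟨ +-monoʳ-≤ (ι 32 * sq f) (*-nonNeg 0≤m₅ 0≤box) ⟩
      ι 32 * sq f + m₅ * box          ≤⟨ choice ⟩
      (ι 64 * (r * f)) * X            ≡⟨ solve 3 (λ r f x → (con (ι 64) :* (r :* f)) :* x := con (ι 32) :* f :* (con (ι 2) :* (r :* x))) refl r f X ⟩
      ι 32 * f * (ι 2 * (r * X))      ∎)
    0<X : 0ℚ < X
    0<X = *-cancelˡ-<-nonNeg (ι 2 * r) {{nonNegative (*-nonNeg (0≤ι 2) (<⇒≤ 0<r))}}
      (subst₂ _<_ (sym (*-zeroʳ (ι 2 * r))) (sym (*-assoc (ι 2) r X)) (<-≤-trans 0<f f≤))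

  module Choice (M : ℕ) .{{_ : ℕ.NonZero M}} (2≤M : 2 ℕ.≤ M) where
    open Counting M
    private m = ι M

    -- By `few`, quadruples with a missing pattern contribute at most as much as the typical ones,
    -- even scaled up by `M`^5; hence the 2.
    total-directions-≤ : ∀ n → (m ^ℚ 5) * (ι 31 ^ℚ n) ≤ ι 32 ^ℚ n →
      (m ^ℚ 5) * total (direction₁ ∷ directions) n ≤ ι 2 * ((ι 16 * m) ^ℚ n)
    total-directions-≤ n few = *-cancelˡ-≤′ (^-pos (ι-pos 2) n) (begin
      (ι 2 ^ℚ n) * ((m ^ℚ 5) * T)
        ≡⟨ sym (*-assoc (ι 2 ^ℚ n) (m ^ℚ 5) T) ⟩
      ((ι 2 ^ℚ n) * (m ^ℚ 5)) * T
        ≤⟨ total-≤ 2≤M (direction₁ ∷ directions) n ⟩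
      ((ι 32 * m) ^ℚ n) + (m ^ℚ 5) * ((ι 31 * m) ^ℚ n)
        ≡⟨ cong₂ (λ a b → a + (m ^ℚ 5) * b) (^-distribʳ-* (ι 32) m n) (^-distribʳ-* (ι 31) m n) ⟩
      (ι 32 ^ℚ n) * (m ^ℚ n) + (m ^ℚ 5) * ((ι 31 ^ℚ n) * (m ^ℚ n))
        ≡⟨ cong ((ι 32 ^ℚ n) * (m ^ℚ n) +_) (sym (*-assoc (m ^ℚ 5) (ι 31 ^ℚ n) (m ^ℚ n))) ⟩
      (ι 32 ^ℚ n) * (m ^ℚ n) + ((m ^ℚ 5) * (ι 31 ^ℚ n)) * (m ^ℚ n)
        ≤⟨ +-monoʳ-≤ ((ι 32 ^ℚ n) * (m ^ℚ n)) (*-monoʳ-≤′ (^-nonNeg (0≤ι M) n) few) ⟩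
      (ι 32 ^ℚ n) * (m ^ℚ n) + (ι 32 ^ℚ n) * (m ^ℚ n)
        ≡⟨ cong (λ a → a * (m ^ℚ n) + a * (m ^ℚ n)) (^-distribʳ-* (ι 2) (ι 16) n) ⟩
      ((ι 2 ^ℚ n) * (ι 16 ^ℚ n)) * (m ^ℚ n) + ((ι 2 ^ℚ n) * (ι 16 ^ℚ n)) * (m ^ℚ n)
        ≡⟨ solve 3 (λ a b c → (a :* b) :* c :+ (a :* b) :* c := a :* (con (ι 2) :* (b :* c))) refl (ι 2 ^ℚ n) (ι 16 ^ℚ n) (m ^ℚ n) ⟩
      (ι 2 ^ℚ n) * (ι 2 * ((ι 16 ^ℚ n) * (m ^ℚ n)))
        ≡⟨ cong (λ a → (ι 2 ^ℚ n) * (ι 2 * a)) (sym (^-distribʳ-* (ι 16) m n)) ⟩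
      (ι 2 ^ℚ n) * (ι 2 * ((ι 16 * m) ^ℚ n)) ∎)
      where
      open ≤-Reasoning
      T = total (direction₁ ∷ directions) n

    -- A small box sum and a large mass are needed for the same `w` and `θ`, so both are packed into
    -- one averaged inequality: dropping either summand on the left gives one of them. The 32
    -- balances the summands, being 16 from sparseness times 2 from `total-directions-≤`.
    good-weights : ∀ n R → n ℕ.* M ℕ.< R → (m ^ℚ 5) * (ι 31 ^ℚ n) ≤ ι 32 ^ℚ n →
      let f = (ι 2 ^ℚ n) * (ι 2 ^ℚ n) in
      ∃₂ λ (w : Vec (Fin M) n) (θ : Fin R) →
        ι 32 * sq f + (m ^ℚ 5) * Threshold.box w (toℕ θ) ≤ (ι 64 * (ι R * f)) * Threshold.mass w (toℕ θ)
    good-weights n R nM<R few = proj₁ on-w , on-θ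
      where
      open ≤-Reasoning
      f = (ι 2 ^ℚ n) * (ι 2 ^ℚ n)
      m₅ = m ^ℚ 5
      r = ι R
      W = weights n
      Θ = allFin R
      T = total (direction₁ ∷ directions) n
      lhs rhs : Vec (Fin M) n → Fin R → ℚ
      lhs w θ = ι 32 * sq f + m₅ * Threshold.box w (toℕ θ)
      rhs w θ = (ι 64 * (r * f)) * Threshold.mass w (toℕ θ)
      16ⁿ : (ι 16 * m) ^ℚ n ≡ sq f * (m ^ℚ n)
      16ⁿ = trans (^-distribʳ-* (ι 16) m n) (cong (_* (m ^ℚ n))
        (trans (^-distribʳ-* (ι 4) (ι 4) n) (cong sq (^-distribʳ-* (ι 2) (ι 2) n))))
      lhs-≤ : ∑[ w ∈ W ] ∑[ θ ∈ Θ ] lhs w θ ≤ (ι 64 * r) * (sq f * (m ^ℚ n))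
      lhs-≤ = begin
        ∑[ w ∈ W ] ∑[ θ ∈ Θ ] lhs w θ
          ≡⟨ ∑-swap W Θ lhs ⟩
        ∑[ θ ∈ Θ ] ∑[ w ∈ W ] lhs w θ
          ≡⟨ ∑-cong Θ (λ θ → trans (∑-distrib-+ W (λ _ → ι 32 * sq f) (λ w → m₅ * Threshold.box w (toℕ θ)))
               (cong₂ _+_ (count-weights n (ι 32 * sq f)) (∑-*ˡ W m₅ (λ w → Threshold.box w (toℕ θ))))) ⟩
        ∑[ θ ∈ Θ ] ((m ^ℚ n) * (ι 32 * sq f) + m₅ * (∑[ w ∈ W ] Threshold.box w (toℕ θ)))
          ≤⟨ ∑-mono Θ (λ θ → +-monoʳ-≤ ((m ^ℚ n) * (ι 32 * sq f)) (*-monoˡ-≤′ (^-nonNeg (0≤ι M) 5) (∑-box-≤ n (toℕ θ)))) ⟩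
        ∑[ θ ∈ Θ ] ((m ^ℚ n) * (ι 32 * sq f) + m₅ * (ι 16 * T))
          ≡⟨ ∑-range-const R _ ⟩
        r * ((m ^ℚ n) * (ι 32 * sq f) + m₅ * (ι 16 * T))
          ≡⟨ cong (λ a → r * ((m ^ℚ n) * (ι 32 * sq f) + a)) (solve 2 (λ m t → m :* (con (ι 16) :* t) := con (ι 16) :* (m :* t)) refl m₅ T) ⟩
        r * ((m ^ℚ n) * (ι 32 * sq f) + ι 16 * (m₅ * T))
          ≤⟨ *-monoˡ-≤′ (0≤ι R) (+-monoʳ-≤ ((m ^ℚ n) * (ι 32 * sq f)) (*-monoˡ-≤′ (0≤ι 16) (total-directions-≤ n few))) ⟩
        r * ((m ^ℚ n) * (ι 32 * sq f) + ι 16 * (ι 2 * ((ι 16 * m) ^ℚ n)))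
          ≡⟨ cong (λ a → r * ((m ^ℚ n) * (ι 32 * sq f) + ι 16 * (ι 2 * a))) 16ⁿ ⟩
        r * ((m ^ℚ n) * (ι 32 * sq f) + ι 16 * (ι 2 * (sq f * (m ^ℚ n))))
          ≡⟨ solve 3 (λ r m f → r :* (m :* (con (ι 32) :* f) :+ con (ι 16) :* (con (ι 2) :* (f :* m))) := (con (ι 64) :* r) :* (f :* m)) refl r (m ^ℚ n) (sq f) ⟩
        (ι 64 * r) * (sq f * (m ^ℚ n)) ∎
      rhs-≥ : (ι 64 * r) * (sq f * (m ^ℚ n)) ≤ ∑[ w ∈ W ] ∑[ θ ∈ Θ ] rhs w θ
      rhs-≥ = begin
        (ι 64 * r) * (sq f * (m ^ℚ n))
          ≡⟨ solve 3 (λ r f m → (con (ι 64) :* r) :* ((f :* f) :* m) := m :* ((con (ι 64) :* (r :* f)) :* f)) refl r f (m ^ℚ n) ⟩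
        (m ^ℚ n) * ((ι 64 * (r * f)) * f)
          ≡⟨ sym (count-weights n ((ι 64 * (r * f)) * f)) ⟩
        ∑[ w ∈ W ] ((ι 64 * (r * f)) * f)
          ≤⟨ ∑-mono W (λ w → *-monoˡ-≤′ (*-nonNeg (0≤ι 64) (*-nonNeg (0≤ι R) (*-nonNeg (^-nonNeg (0≤ι 2) n) (^-nonNeg (0≤ι 2) n)))) (∑-mass-≥ R nM<R w)) ⟩
        ∑[ w ∈ W ] ((ι 64 * (r * f)) * (∑[ θ ∈ Θ ] Threshold.mass w (toℕ θ)))
          ≡⟨ ∑-cong W (λ w → sym (∑-*ˡ Θ (ι 64 * (r * f)) (λ θ → Threshold.mass w (toℕ θ)))) ⟩
        ∑[ w ∈ W ] ∑[ θ ∈ Θ ] rhs w θ ∎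
      0<∣W∣ : 0 ℕ.< length W
      0<∣W∣ = subst (0 ℕ.<_) (sym (trans (length-vecs (allFin M) n) (cong (ℕ._^ n) (Listₚ.length-tabulate {n = M} id))))
        (ℕₚ.m^n>0 M n)
      0<∣Θ∣ : 0 ℕ.< length Θ
      0<∣Θ∣ = subst (0 ℕ.<_) (sym (Listₚ.length-tabulate {n = R} id)) (ℕₚ.≤-<-trans ℕ.z≤n nM<R)
      on-w : ∃ λ w → ∑[ θ ∈ Θ ] lhs w θ ≤ ∑[ θ ∈ Θ ] rhs w θ
      on-w = ∑-pigeonhole W _ _ 0<∣W∣ (≤-trans lhs-≤ rhs-≥)
      on-θ : ∃ λ θ → lhs (proj₁ on-w) θ ≤ rhs (proj₁ on-w) θ
      on-θ = ∑-pigeonhole Θ _ _ 0<∣Θ∣ (proj₂ on-w)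

    hard-threshold : ∀ n R → n ℕ.* M ℕ.< R → (m ^ℚ 5) * (ι 31 ^ℚ n) ≤ ι 32 ^ℚ n →
      ∃₂ λ (w : Vec (Fin M) n) (θ : Fin R) → ∀ P ε → 0ℚ ≤ ε → Computes P (threshold w (toℕ θ)) ε →
        sq (sq ε) * (m ^ℚ 5) ≤ ι 32 * (ι (16 ℕ.^ cost P) * sq (sq (ι R)))
    hard-threshold n R nM<R few = w , θ , bound
      where
      choice = good-weights n R nM<R few
      w = proj₁ choice
      θ = proj₁ (proj₂ choice)
      open Threshold w (toℕ θ)
      f = (ι 2 ^ℚ n) * (ι 2 ^ℚ n)
      0<2ⁿ = ^-pos (ι-pos 2) n
      0<r : 0ℚ < ι R
      0<r = <-≤-trans (ι-pos 1) (ι-mono (ℕₚ.≤-<-trans ℕ.z≤n nM<R))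
      mass-nonNeg : 0ℚ ≤ mass
      mass-nonNeg = ∑-nonNeg (cube n) (λ u → ∑-nonNeg (cube n) (λ v → 0≤∣p∣ (jump (toℕ θ) (dot w u v))))
      advantage : ∀ P ε → 0ℚ ≤ ε → Computes P (threshold w (toℕ θ)) ε →
        sq (sq ((ε + ε) * mass)) ≤ ι (16 ℕ.^ cost P) * (f * (f * box))
      advantage P ε 0≤ε computes = subst (λ l → sq (sq ((ε + ε) * mass)) ≤ ι (16 ℕ.^ cost P) * (sq l * (sq l * box)))
        (trans (cong ι (length-vecs bools n)) (ι-^ 2 n))
        (advantage-bound P (threshold w (toℕ θ)) ε
          (λ u v → jump-nonNeg (dot w u v) (toℕ θ) , jump-nonPos (dot w u v) (toℕ θ)) 0≤ε computes)
      bound : ∀ P ε → 0ℚ ≤ ε → Computes P (threshold w (toℕ θ)) ε →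
        sq (sq ε) * (m ^ℚ 5) ≤ ι 32 * (ι (16 ℕ.^ cost P) * sq (sq (ι R)))
      bound P ε 0≤ε computes = advantage-from-choice {f} {m ^ℚ 5} {box} {ι R} {mass} {ι (16 ℕ.^ cost P)} {ε}
        (0<-* 0<2ⁿ 0<2ⁿ) (^-nonNeg (0≤ι M) 5) box-nonNeg 0<r mass-nonNeg (0≤ι (16 ℕ.^ cost P))
        (proj₂ (proj₂ choice)) (advantage P ε 0≤ε computes)

  -- Numerical choice of the parameters.

  1+n≤2^n : ∀ n → suc n ℕ.≤ 2 ℕ.^ n
  1+n≤2^n zero    = ℕₚ.≤-refl
  1+n≤2^n (suc n) = ℕₚ.+-mono-≤ (ℕₚ.m^n>0 2 n) (ℕₚ.≤-trans (1+n≤2^n n) (ℕₚ.≤-reflexive (sym (ℕₚ.+-identityʳ _))))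

  ^ℕ-distribʳ-* : ∀ n a b → (a ℕ.* b) ℕ.^ n ≡ a ℕ.^ n ℕ.* b ℕ.^ n
  ^ℕ-distribʳ-* zero    a b = refl
  ^ℕ-distribʳ-* (suc n) a b = trans (cong (a ℕ.* b ℕ.*_) (^ℕ-distribʳ-* n a b)) (ℕₚ.[m*n]*[o*p]≡[m*o]*[n*p] a b (a ℕ.^ n) (b ℕ.^ n))

  -- Spreads one numerical inequality to all exponents: its k-th power covers full blocks of length
  -- `s`, and `b ≤ c` pads the remainder.
  ^-*-≤-^ : ∀ a b c s t k j → a ℕ.^ t ℕ.* b ℕ.^ s ℕ.≤ c ℕ.^ s → b ℕ.≤ c →
    a ℕ.^ (t ℕ.* k) ℕ.* b ℕ.^ (s ℕ.* k ℕ.+ j) ℕ.≤ c ℕ.^ (s ℕ.* k ℕ.+ j)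
  ^-*-≤-^ a b c s t k j base b≤c = begin
    a ℕ.^ (t ℕ.* k) ℕ.* b ℕ.^ (s ℕ.* k ℕ.+ j)
      ≡⟨ cong₂ ℕ._*_ (sym (ℕₚ.^-*-assoc a t k)) (trans (ℕₚ.^-distribˡ-+-* b (s ℕ.* k) j) (cong (ℕ._* b ℕ.^ j) (sym (ℕₚ.^-*-assoc b s k)))) ⟩
    (a ℕ.^ t) ℕ.^ k ℕ.* ((b ℕ.^ s) ℕ.^ k ℕ.* b ℕ.^ j)
      ≡⟨ sym (ℕₚ.*-assoc ((a ℕ.^ t) ℕ.^ k) _ _) ⟩
    (a ℕ.^ t) ℕ.^ k ℕ.* (b ℕ.^ s) ℕ.^ k ℕ.* b ℕ.^ j
      ≡⟨ cong (ℕ._* b ℕ.^ j) (sym (^ℕ-distribʳ-* k (a ℕ.^ t) (b ℕ.^ s))) ⟩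
    (a ℕ.^ t ℕ.* b ℕ.^ s) ℕ.^ k ℕ.* b ℕ.^ j
      ≤⟨ ℕₚ.*-mono-≤ (ℕₚ.^-monoˡ-≤ k base) (ℕₚ.^-monoˡ-≤ j b≤c) ⟩
    (c ℕ.^ s) ℕ.^ k ℕ.* c ℕ.^ j
      ≡⟨ cong (ℕ._* c ℕ.^ j) (ℕₚ.^-*-assoc c s k) ⟩
    c ℕ.^ (s ℕ.* k) ℕ.* c ℕ.^ j
      ≡⟨ sym (ℕₚ.^-distribˡ-+-* c (s ℕ.* k) j) ⟩
    c ℕ.^ (s ℕ.* k ℕ.+ j) ∎
    where open ℕₚ.≤-Reasoning

  -- 40 = 5 · 8 comes from `M`^5 with `M` = 2^(8k), and 1024 is a power of two long enough for it:
  -- (32/31)^1024 is close to 2^47. Checked by evaluation.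
  2^40*31^1024≤32^1024 : 2 ℕ.^ 40 ℕ.* 31 ℕ.^ 1024 ℕ.≤ 32 ℕ.^ 1024
  2^40*31^1024≤32^1024 = ℕₚ.≤ᵇ⇒≤ (2 ℕ.^ 40 ℕ.* 31 ℕ.^ 1024) (32 ℕ.^ 1024) _

  ι-2^-+ : ∀ a b → ι (2 ℕ.^ (a ℕ.+ b)) ≡ ι (2 ℕ.^ a) * ι (2 ℕ.^ b)
  ι-2^-+ a b = trans (cong ι (ℕₚ.^-distribˡ-+-* 2 a b)) (ι-* (2 ℕ.^ a) (2 ℕ.^ b))

  cancel-2^ : ∀ e a b d → e * ι (2 ℕ.^ (a ℕ.+ b)) ≤ ι (2 ℕ.^ (a ℕ.+ d)) → e * ι (2 ℕ.^ b) ≤ ι (2 ℕ.^ d)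
  cancel-2^ e a b d h = *-cancelˡ-≤′ (ι-pos (2 ℕ.^ a) {{ℕₚ.m^n≢0 2 a}}) (subst₂ _≤_
    (trans (cong (e *_) (ι-2^-+ a b)) (solve 3 (λ e a b → e :* (a :* b) := a :* (e :* b)) refl e (ι (2 ℕ.^ a)) (ι (2 ℕ.^ b))))
    (ι-2^-+ a d) h)

  collect-2^ : ∀ s c r → ι (2 ℕ.^ s) * (ι (16 ℕ.^ c) * sq (sq (ι (2 ℕ.^ r)))) ≡
    ι (2 ℕ.^ (s ℕ.+ (4 ℕ.* c ℕ.+ ((r ℕ.+ r) ℕ.+ (r ℕ.+ r)))))
  collect-2^ s c r = sym (trans (ι-2^-+ s _) (cong (ι (2 ℕ.^ s) *_) (trans (ι-2^-+ (4 ℕ.* c) _)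
    (cong₂ _*_ (cong ι (sym (ℕₚ.^-*-assoc 2 4 c))) (trans (ι-2^-+ (r ℕ.+ r) (r ℕ.+ r)) (cong sq (ι-2^-+ r r)))))))

  -- Here n < 2^(10+k), hence n`M` < `R` = 2^(10+9k). The gain `M`^5 = 2^(40k) against the loss
  -- `R`^4 = 2^(40+36k) leaves 2^(4k), and 45 is 40 plus 5 for the factor 32.
  hard-threshold-at : ∀ k j → 0 ℕ.< k → j ℕ.< 1024 →
    ∃₂ λ (w : Vec (Fin (2 ℕ.^ (8 ℕ.* k))) (1024 ℕ.* k ℕ.+ j)) (θ : Fin (2 ℕ.^ (10 ℕ.+ 9 ℕ.* k))) →
      ∀ P ε → 0ℚ ≤ ε → Computes P (threshold w (toℕ θ)) ε →
        sq (sq ε) * ι (2 ℕ.^ (4 ℕ.* k)) ≤ ι (2 ℕ.^ (45 ℕ.+ 4 ℕ.* cost P))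
  hard-threshold-at k j 0<k j<1024 = proj₁ core , proj₁ (proj₂ core) , λ P ε 0≤ε computes →
    rescale (sq (sq ε)) (cost P) (proj₂ (proj₂ core) P ε 0≤ε computes)
    where
    n = 1024 ℕ.* k ℕ.+ j
    M = 2 ℕ.^ (8 ℕ.* k)
    R = 2 ℕ.^ (10 ℕ.+ 9 ℕ.* k)
    instance
      M≢0 : ℕ.NonZero M
      M≢0 = ℕₚ.m^n≢0 2 (8 ℕ.* k)
    2≤M : 2 ℕ.≤ M
    2≤M = ℕₚ.^-monoʳ-≤ 2 {1} {8 ℕ.* k} (ℕₚ.≤-trans 0<k (ℕₚ.m≤n*m k 8))
    nM<R : n ℕ.* M ℕ.< R
    nM<R = begin-strict
      n ℕ.* M                                          <⟨ ℕₚ.*-monoˡ-< M n< ⟩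
      2 ℕ.^ 10 ℕ.* 2 ℕ.^ k ℕ.* 2 ℕ.^ (8 ℕ.* k)         ≡⟨ ℕₚ.*-assoc (2 ℕ.^ 10) (2 ℕ.^ k) _ ⟩
      2 ℕ.^ 10 ℕ.* (2 ℕ.^ k ℕ.* 2 ℕ.^ (8 ℕ.* k))       ≡⟨ cong (2 ℕ.^ 10 ℕ.*_) (sym (ℕₚ.^-distribˡ-+-* 2 k (8 ℕ.* k))) ⟩
      2 ℕ.^ 10 ℕ.* 2 ℕ.^ (9 ℕ.* k)                     ≡⟨ sym (ℕₚ.^-distribˡ-+-* 2 10 (9 ℕ.* k)) ⟩
      R ∎
      where
      open ℕₚ.≤-Reasoning
      n< : n ℕ.< 2 ℕ.^ 10 ℕ.* 2 ℕ.^ k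
      n< = begin-strict
        1024 ℕ.* k ℕ.+ j        <⟨ ℕₚ.+-monoʳ-< (1024 ℕ.* k) j<1024 ⟩
        1024 ℕ.* k ℕ.+ 1024     ≡⟨ trans (ℕₚ.+-comm (1024 ℕ.* k) 1024) (sym (ℕₚ.*-suc 1024 k)) ⟩
        1024 ℕ.* suc k          ≤⟨ ℕₚ.*-monoʳ-≤ 1024 (1+n≤2^n k) ⟩
        2 ℕ.^ 10 ℕ.* 2 ℕ.^ k    ∎
    8k*5≡40k : ∀ k → 8 ℕ.* k ℕ.* 5 ≡ 40 ℕ.* k
    8k*5≡40k = solve-∀
    M^5 : M ℕ.^ 5 ≡ 2 ℕ.^ (40 ℕ.* k)
    M^5 = trans (ℕₚ.^-*-assoc 2 (8 ℕ.* k) 5) (cong (2 ℕ.^_) (8k*5≡40k k))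
    few : (ι M ^ℚ 5) * (ι 31 ^ℚ n) ≤ ι 32 ^ℚ n
    few = subst₂ _≤_
      (trans (ι-* (2 ℕ.^ (40 ℕ.* k)) (31 ℕ.^ n)) (cong₂ _*_ (trans (cong ι (sym M^5)) (ι-^ M 5)) (ι-^ 31 n)))
      (ι-^ 32 n)
      (ι-mono (^-*-≤-^ 2 31 32 1024 40 k j 2^40*31^1024≤32^1024 (ℕₚ.n≤1+n 31)))
    core = Choice.hard-threshold M 2≤M n R nM<R few
    total-exponent : ∀ c k → 5 ℕ.+ (4 ℕ.* c ℕ.+ ((10 ℕ.+ 9 ℕ.* k ℕ.+ (10 ℕ.+ 9 ℕ.* k)) ℕ.+ (10 ℕ.+ 9 ℕ.* k ℕ.+ (10 ℕ.+ 9 ℕ.* k)))) ≡ 36 ℕ.* k ℕ.+ (45 ℕ.+ 4 ℕ.* c)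
    total-exponent = solve-∀
    rescale : ∀ e c → e * (ι M ^ℚ 5) ≤ ι 32 * (ι (16 ℕ.^ c) * sq (sq (ι R))) → e * ι (2 ℕ.^ (4 ℕ.* k)) ≤ ι (2 ℕ.^ (45 ℕ.+ 4 ℕ.* c))
    rescale e c h = cancel-2^ e (36 ℕ.* k) (4 ℕ.* k) (45 ℕ.+ 4 ℕ.* c)
      (≤-trans (≤-reflexive (cong (e *_) (trans (cong (λ i → ι (2 ℕ.^ i)) (sym (ℕₚ.*-distribʳ-+ k 36 4))) (trans (cong ι (sym M^5)) (ι-^ M 5)))))
      (≤-trans h (≤-reflexive (trans (collect-2^ 5 c (10 ℕ.+ 9 ℕ.* k)) (cong (λ i → ι (2 ℕ.^ i)) (total-exponent c k))))))

  -- From a fourth-power bound to a bound on PP.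

  ^-distribˡ-+-* : ∀ x a b → x ^ℚ (a ℕ.+ b) ≡ (x ^ℚ a) * (x ^ℚ b)
  ^-distribˡ-+-* x zero    b = sym (*-identityˡ (x ^ℚ b))
  ^-distribˡ-+-* x (suc a) b = trans (cong (x *_) (^-distribˡ-+-* x a b)) (sym (*-assoc x (x ^ℚ a) (x ^ℚ b)))

  ^-*-assoc : ∀ x a b → (x ^ℚ a) ^ℚ b ≡ x ^ℚ (b ℕ.* a)
  ^-*-assoc x a zero    = refl
  ^-*-assoc x a (suc b) = trans (cong ((x ^ℚ a) *_) (^-*-assoc x a b)) (sym (^-distribˡ-+-* x a (b ℕ.* a)))

  ^-mono : 0ℚ ≤ x → x ≤ y → ∀ n → x ^ℚ n ≤ y ^ℚ n
  ^-mono 0≤x x≤y zero    = ≤-refl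
  ^-mono 0≤x x≤y (suc n) = *-mono-≤-nonNeg 0≤x x≤y (^-nonNeg 0≤x n) (^-mono 0≤x x≤y n)

  1^n≡1 : ∀ n → 1ℚ ^ℚ n ≡ 1ℚ
  1^n≡1 zero    = refl
  1^n≡1 (suc n) = trans (*-identityˡ (1ℚ ^ℚ n)) (1^n≡1 n)

  -- An advantage is at most ½, so each spare factor ε pays for a factor 2.
  half-^ : ∀ {ε} → 0ℚ ≤ ε → ε * ι 2 ≤ 1ℚ → ∀ n → (ε ^ℚ n) * ι (2 ℕ.^ n) ≤ 1ℚ
  half-^ {ε} 0≤ε 2ε≤1 n = subst₂ _≤_
    (trans (^-distribʳ-* ε (ι 2) n) (cong ((ε ^ℚ n) *_) (sym (ι-^ 2 n)))) (1^n≡1 n)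
    (^-mono (*-nonNeg 0≤ε (0≤ι 2)) 2ε≤1 n)

  -- The exponent `D * (5 + s)` has three sources: 4 from the given bound, `s` factors ε paying for
  -- 2^s, all raised to the power `D` to stretch k to N, and `D` more factors paying for the
  -- additive `D` in N ≤ Dk + D.
  amplify : ∀ ε → 0ℚ ≤ ε → ε * ι 2 ≤ 1ℚ → ∀ s D k c N →
    sq (sq ε) * ι (2 ℕ.^ (4 ℕ.* k)) ≤ ι (2 ℕ.^ (s ℕ.+ 4 ℕ.* c)) → N ℕ.≤ D ℕ.* k ℕ.+ D →
    (ε ^ℚ (D ℕ.* (5 ℕ.+ s))) * ι (2 ℕ.^ N) ≤ ι (2 ℕ.^ (D ℕ.* (5 ℕ.+ s) ℕ.* c))
  amplify ε 0≤ε 2ε≤1 s D k c N h N≤ = begin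
    (ε ^ℚ (D ℕ.* (5 ℕ.+ s))) * ι (2 ℕ.^ N)
      ≤⟨ *-monoˡ-≤′ (^-nonNeg 0≤ε (D ℕ.* (5 ℕ.+ s))) (ι-mono (ℕₚ.^-monoʳ-≤ 2 N≤′)) ⟩
    (ε ^ℚ (D ℕ.* (5 ℕ.+ s))) * ι (2 ℕ.^ (D ℕ.+ D ℕ.* (4 ℕ.* k)))
      ≡⟨ cong₂ _*_ (trans (cong (ε ^ℚ_) (ℕₚ.*-suc D (4 ℕ.+ s))) (^-distribˡ-+-* ε D (D ℕ.* (4 ℕ.+ s))))
           (ι-2^-+ D (D ℕ.* (4 ℕ.* k))) ⟩
    ((ε ^ℚ D) * (ε ^ℚ (D ℕ.* (4 ℕ.+ s)))) * (ι (2 ℕ.^ D) * ι (2 ℕ.^ (D ℕ.* (4 ℕ.* k))))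
      ≡⟨ solve 4 (λ a b c d → (a :* b) :* (c :* d) := (a :* c) :* (b :* d)) refl
           (ε ^ℚ D) (ε ^ℚ (D ℕ.* (4 ℕ.+ s))) (ι (2 ℕ.^ D)) (ι (2 ℕ.^ (D ℕ.* (4 ℕ.* k)))) ⟩
    ((ε ^ℚ D) * ι (2 ℕ.^ D)) * ((ε ^ℚ (D ℕ.* (4 ℕ.+ s))) * ι (2 ℕ.^ (D ℕ.* (4 ℕ.* k))))
      ≤⟨ *-mono-≤-nonNeg (*-nonNeg (^-nonNeg 0≤ε D) (0≤ι (2 ℕ.^ D))) (half-^ 0≤ε 2ε≤1 D)
           (*-nonNeg (^-nonNeg 0≤ε (D ℕ.* (4 ℕ.+ s))) (0≤ι (2 ℕ.^ (D ℕ.* (4 ℕ.* k))))) powered ⟩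
    1ℚ * ι (2 ℕ.^ (D ℕ.* (4 ℕ.* c)))
      ≡⟨ *-identityˡ _ ⟩
    ι (2 ℕ.^ (D ℕ.* (4 ℕ.* c)))
      ≤⟨ ι-mono (ℕₚ.^-monoʳ-≤ 2 (ℕₚ.≤-trans (ℕₚ.≤-reflexive (sym (ℕₚ.*-assoc D 4 c)))
           (ℕₚ.*-monoˡ-≤ c (ℕₚ.*-monoʳ-≤ D (ℕₚ.≤-trans (ℕₚ.n≤1+n 4) (ℕₚ.m≤m+n 5 s)))))) ⟩
    ι (2 ℕ.^ (D ℕ.* (5 ℕ.+ s) ℕ.* c)) ∎
    where
    open ≤-Reasoning
    N≤′ : N ℕ.≤ D ℕ.+ D ℕ.* (4 ℕ.* k)
    N≤′ = ℕₚ.≤-trans N≤ (ℕₚ.≤-trans (ℕₚ.≤-reflexive (ℕₚ.+-comm (D ℕ.* k) D)) (ℕₚ.+-monoʳ-≤ D (ℕₚ.*-monoʳ-≤ D (ℕₚ.m≤n*m k 4))))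
    single : (ε ^ℚ (4 ℕ.+ s)) * ι (2 ℕ.^ (4 ℕ.* k)) ≤ ι (2 ℕ.^ (4 ℕ.* c))
    single = begin
      (ε ^ℚ (4 ℕ.+ s)) * ι (2 ℕ.^ (4 ℕ.* k))
        ≡⟨ solve 3 (λ e p q → (e :* (e :* (e :* (e :* p)))) :* q := p :* (((e :* e) :* (e :* e)) :* q)) refl ε (ε ^ℚ s) (ι (2 ℕ.^ (4 ℕ.* k))) ⟩
      (ε ^ℚ s) * (sq (sq ε) * ι (2 ℕ.^ (4 ℕ.* k)))
        ≤⟨ *-monoˡ-≤′ (^-nonNeg 0≤ε s) h ⟩
      (ε ^ℚ s) * ι (2 ℕ.^ (s ℕ.+ 4 ℕ.* c))
        ≡⟨ trans (cong ((ε ^ℚ s) *_) (ι-2^-+ s (4 ℕ.* c))) (sym (*-assoc (ε ^ℚ s) (ι (2 ℕ.^ s)) (ι (2 ℕ.^ (4 ℕ.* c))))) ⟩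
      ((ε ^ℚ s) * ι (2 ℕ.^ s)) * ι (2 ℕ.^ (4 ℕ.* c))
        ≤⟨ *-monoʳ-≤′ (0≤ι (2 ℕ.^ (4 ℕ.* c))) (half-^ 0≤ε 2ε≤1 s) ⟩
      1ℚ * ι (2 ℕ.^ (4 ℕ.* c))
        ≡⟨ *-identityˡ _ ⟩
      ι (2 ℕ.^ (4 ℕ.* c)) ∎
    2^-^ : ∀ e → ι (2 ℕ.^ e) ^ℚ D ≡ ι (2 ℕ.^ (D ℕ.* e))
    2^-^ e = trans (sym (ι-^ (2 ℕ.^ e) D)) (cong ι (trans (ℕₚ.^-*-assoc 2 e D) (cong (2 ℕ.^_) (ℕₚ.*-comm e D))))
    powered : (ε ^ℚ (D ℕ.* (4 ℕ.+ s))) * ι (2 ℕ.^ (D ℕ.* (4 ℕ.* k))) ≤ ι (2 ℕ.^ (D ℕ.* (4 ℕ.* c)))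
    powered = subst₂ _≤_
      (trans (^-distribʳ-* (ε ^ℚ (4 ℕ.+ s)) (ι (2 ℕ.^ (4 ℕ.* k))) D) (cong₂ _*_ (^-*-assoc ε (4 ℕ.+ s) D) (2^-^ (4 ℕ.* k))))
      (2^-^ (4 ℕ.* c))
      (^-mono (*-nonNeg (^-nonNeg 0≤ε (4 ℕ.+ s)) (0≤ι (2 ℕ.^ (4 ℕ.* k)))) single D)

  -- A success probability cannot exceed 1. An input pair is required because over empty inputs
  -- `Computes` holds for every ε.
  computes⇒2ε≤1 : ∀ {X Y : Set} (P : Protocol X Y) G ε → X → Y → Computes P G ε → ε * ι 2 ≤ 1ℚ
  computes⇒2ε≤1 P G ε x y computes = 0≤y-x⇒x≤y (subst (0ℚ ≤_)
    (solve 1 (λ e → (con 1ℚ :- (con ½ :+ e)) :+ (con 1ℚ :- (con ½ :+ e)) := con 1ℚ :- e :* con (ι 2)) refl ε)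
    (+-nonNeg half half))
    where half = x≤y⇒0≤y-x (≤-trans (computes x y) (probOut≤1 P x y (G x y)))

  PP≥-intro : ∀ {X Y : Set} {G : X → Y → Bool} → X → Y → ∀ s D k N →
    (∀ P ε → 0ℚ ≤ ε → Computes P G ε → sq (sq ε) * ι (2 ℕ.^ (4 ℕ.* k)) ≤ ι (2 ℕ.^ (s ℕ.+ 4 ℕ.* cost P))) →
    N ℕ.≤ D ℕ.* k ℕ.+ D → PP≥ G (D ℕ.* (5 ℕ.+ s)) N
  PP≥-intro {G = G} x y s D k N bound N≤ P ε 0<ε computes = subst₂ _≤_
    (cong ((ε ^ℚ (D ℕ.* (5 ℕ.+ s))) *_) (sym (+n/1≡ιn (2 ℕ.^ N))))
    (sym (+n/1≡ιn (2 ℕ.^ (D ℕ.* (5 ℕ.+ s) ℕ.* cost P))))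
    (amplify ε 0≤ε (computes⇒2ε≤1 P G ε x y computes) s D k (cost P) N (bound P ε 0≤ε computes) N≤)
    where 0≤ε = <⇒≤ 0<ε

  -- Restrictions, and hard thresholds in every dimension.

  module Pullback {X Y X′ Y′ : Set} (α : X → X′) (β : Y → Y′) where

    pullback : Protocol X′ Y′ → Protocol X Y
    pullback (leaf o)          = leaf o
    pullback (alice p u P₀ P₁) = alice (λ x → p (α x)) (λ x → u (α x)) (pullback P₀) (pullback P₁)
    pullback (bob p u P₀ P₁)   = bob (λ y → p (β y)) (λ y → u (β y)) (pullback P₀) (pullback P₁)

    cost-pullback : ∀ P → cost (pullback P) ≡ cost P
    cost-pullback (leaf o)          = refl
    cost-pullback (alice p u P₀ P₁) = cong suc (cong₂ ℕ._⊔_ (cost-pullback P₀) (cost-pullback P₁))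
    cost-pullback (bob p u P₀ P₁)   = cong suc (cong₂ ℕ._⊔_ (cost-pullback P₀) (cost-pullback P₁))

    probOut-pullback : ∀ P x y b → probOut (pullback P) x y b ≡ probOut P (α x) (β y) b
    probOut-pullback (leaf o)          x y b = refl
    probOut-pullback (alice p u P₀ P₁) x y b = cong₂ (λ s t → p (α x) * s + (1ℚ - p (α x)) * t)
      (probOut-pullback P₁ x y b) (probOut-pullback P₀ x y b)
    probOut-pullback (bob p u P₀ P₁)   x y b = cong₂ (λ s t → p (β y) * s + (1ℚ - p (β y)) * t)
      (probOut-pullback P₁ x y b) (probOut-pullback P₀ x y b)

    -- Each party re-encodes its input locally, so a protocol for `G′` becomes one for `G` with
    -- equal cost and advantage; hardness passes from a restriction to the larger function.
    PP≥-pullback : ∀ {G G′ q N} → (∀ x y → G′ (α x) (β y) ≡ G x y) → PP≥ G q N → PP≥ G′ q N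
    PP≥-pullback {G} {G′} {q} {N} e pp P ε 0<ε computes =
      subst (λ c → (ε ^ℚ q) * ((ℤ.+ (2 ℕ.^ N)) / 1) ≤ (ℤ.+ (2 ℕ.^ (q ℕ.* c))) / 1) (cost-pullback P)
        (pp (pullback P) ε 0<ε (λ x y → subst (½ + ε ≤_)
          (trans (sym (probOut-pullback P x y _)) (cong (probOut (pullback P) x y) (e x y))) (computes (α x) (β y))))

  -- The size limits on `M` and `θ` make weights and threshold fit into the n + 1 binary levels of
  -- the later encoding in GHR.
  HardThreshold : (n s D N : ℕ) → Set
  HardThreshold n s D N = Σ[ M ∈ ℕ ] Σ[ w ∈ Vec (Fin M) n ] Σ[ θ ∈ ℕ ]
    (M ℕ.≤ 2 ℕ.^ suc n) × (θ ℕ.< 2 ℕ.^ suc n) × PP≥ (threshold w θ) (D ℕ.* (5 ℕ.+ s)) N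

  HardThreshold-intro : ∀ {n M} s D k N (w : Vec (Fin M) n) θ → M ℕ.≤ 2 ℕ.^ suc n → θ ℕ.< 2 ℕ.^ suc n →
    (∀ P ε → 0ℚ ≤ ε → Computes P (threshold w θ) ε → sq (sq ε) * ι (2 ℕ.^ (4 ℕ.* k)) ≤ ι (2 ℕ.^ (s ℕ.+ 4 ℕ.* cost P))) →
    N ℕ.≤ D ℕ.* k ℕ.+ D → HardThreshold n s D N
  HardThreshold-intro {n} {M} s D k N w θ M≤ θ< bound N≤ =
    M , w , θ , M≤ , θ< , PP≥-intro (Vec.replicate n false) (Vec.replicate n false) s D k N bound N≤

  -- Dimensions below 1024 have k = 0, where the fourth-power bound follows from ε ≤ 1 for any
  -- function; zero weights serve.
  easy-threshold : ∀ n s D N → N ℕ.≤ D ℕ.* 0 ℕ.+ D → HardThreshold n s D N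
  easy-threshold n s D N = HardThreshold-intro s D 0 N w 0 (ℕₚ.m^n>0 2 (suc n)) (ℕₚ.m^n>0 2 (suc n)) trivial
    where
    w : Vec (Fin 1) n
    w = Vec.replicate n zero
    falses : Vec Bool n
    falses = Vec.replicate n false
    trivial : ∀ P ε → 0ℚ ≤ ε → Computes P (threshold w 0) ε → sq (sq ε) * ι 1 ≤ ι (2 ℕ.^ (s ℕ.+ 4 ℕ.* cost P))
    trivial P ε 0≤ε computes = ≤-trans (*-monoʳ-≤′ (0≤ι 1) (sq-mono (0≤x² ε) (sq-mono 0≤ε ε≤1)))
      (ι-mono (ℕₚ.m^n>0 2 (s ℕ.+ 4 ℕ.* cost P)))
      where
      ε≤1 : ε ≤ 1ℚ
      ε≤1 = ≤-trans (≤-trans (≤-reflexive (sym (*-identityʳ ε))) (*-monoˡ-≤′ 0≤ε (ι-mono (ℕₚ.n≤1+n 1))))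
        (computes⇒2ε≤1 P (threshold w 0) ε falses falses computes)

  10+9k≤1024k+j+1 : ∀ k j → 0 ℕ.< k → 10 ℕ.+ 9 ℕ.* k ℕ.≤ suc (1024 ℕ.* k ℕ.+ j)
  10+9k≤1024k+j+1 k j 0<k = begin
    10 ℕ.+ 9 ℕ.* k           ≤⟨ ℕₚ.+-monoˡ-≤ (9 ℕ.* k) (ℕₚ.m≤m*n 10 k {{ℕ.>-nonZero 0<k}}) ⟩
    10 ℕ.* k ℕ.+ 9 ℕ.* k     ≡⟨ sym (ℕₚ.*-distribʳ-+ k 10 9) ⟩
    19 ℕ.* k                 ≤⟨ ℕₚ.*-monoˡ-≤ k (ℕₚ.m≤m+n 19 1005) ⟩
    1024 ℕ.* k               ≤⟨ ℕₚ.m≤m+n (1024 ℕ.* k) j ⟩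
    1024 ℕ.* k ℕ.+ j         ≤⟨ ℕₚ.n≤1+n _ ⟩
    suc (1024 ℕ.* k ℕ.+ j)   ∎
    where open ℕₚ.≤-Reasoning

  hard-threshold-PP : ∀ k j D N → j ℕ.< 1024 → N ℕ.≤ D ℕ.* k ℕ.+ D → HardThreshold (1024 ℕ.* k ℕ.+ j) 45 D N
  hard-threshold-PP k j D N j<1024 N≤ = case-k (ℕₚ.m≤n⇒m<n∨m≡n {0} {k} ℕ.z≤n)
    where
    case-k : 0 ℕ.< k ⊎ 0 ≡ k → HardThreshold (1024 ℕ.* k ℕ.+ j) 45 D N
    case-k (inj₂ refl) = easy-threshold (1024 ℕ.* 0 ℕ.+ j) 45 D N N≤
    case-k (inj₁ 0<k)  = HardThreshold-intro 45 D k N w (toℕ θ)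
      (ℕₚ.^-monoʳ-≤ 2 (ℕₚ.≤-trans (ℕₚ.≤-trans (ℕₚ.*-monoˡ-≤ k (ℕₚ.n≤1+n 8)) (ℕₚ.m≤n+m (9 ℕ.* k) 10)) (10+9k≤1024k+j+1 k j 0<k)))
      (ℕₚ.<-≤-trans (Finₚ.toℕ<n θ) (ℕₚ.^-monoʳ-≤ 2 (10+9k≤1024k+j+1 k j 0<k)))
      (proj₂ (proj₂ hard)) N≤
      where
      hard = hard-threshold-at k j 0<k j<1024
      w = proj₁ hard
      θ = proj₁ (proj₂ hard)

module Encodings where

  open Analysis using (ι; +n/1≡ιn; ι-mono; 0≤ι; dot; threshold)
  open import Data.Bool using (Bool; true; false; not; _∧_; _xor_; if_then_else_)
  open import Data.Nat as ℕ using (ℕ; zero; suc)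
  import Data.Nat.Properties as ℕₚ
  import Data.Nat.DivMod as ℕ
  open import Data.Integer using (ℤ; +_; -[1+_]; _+_; _*_; -_; _-_; _⊖_; ∣_∣)
  import Data.Integer.Properties as ℤₚ
  open import Data.Integer.Tactic.RingSolver using (solve-∀)
  import Data.Rational as ℚ
  import Data.Rational.Properties as ℚₚ
  open import Data.Vec using (Vec; []; _∷_; lookup)
  open import Data.Vec.Functional as Vector using (Vector; _++_)
  import Data.Vec.Functional.Properties as Vectorₚ
  open import Data.Fin using (Fin; zero; suc; toℕ; _↑ˡ_; _↑ʳ_)
  import Data.Fin.Properties as Finₚ
  open import Data.Product using (_,_)
  open import Function using (_∘_)
  open import Relation.Binary.PropositionalEquality
  open import Relation.Nullary.Decidable using (⌊_⌋; isYes≗does; dec-true; dec-false)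

  -- Integer sums, the product gadget and signs.

  ∑ᶻ-cong : ∀ n {f g : Fin n → ℤ} → (∀ i → f i ≡ g i) → ∑ n f ≡ ∑ n g
  ∑ᶻ-cong zero    e = refl
  ∑ᶻ-cong (suc n) e = cong₂ _+_ (e zero) (∑ᶻ-cong n (e ∘ suc))

  ∑ᶻ-distrib-+ : ∀ n (f g : Fin n → ℤ) → ∑ n (λ i → f i + g i) ≡ ∑ n f + ∑ n g
  ∑ᶻ-distrib-+ zero    f g = refl
  ∑ᶻ-distrib-+ (suc n) f g = trans (cong (_+_ (f zero + g zero)) (∑ᶻ-distrib-+ n (f ∘ suc) (g ∘ suc)))
    (interchange (f zero) (g zero) (∑ n (f ∘ suc)) (∑ n (g ∘ suc)))
    where
    interchange : ∀ a b c d → a + b + (c + d) ≡ a + c + (b + d)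
    interchange = solve-∀

  ∑ᶻ-*ˡ : ∀ n c (f : Fin n → ℤ) → ∑ n (λ i → c * f i) ≡ c * ∑ n f
  ∑ᶻ-*ˡ zero    c f = sym (ℤₚ.*-zeroʳ c)
  ∑ᶻ-*ˡ (suc n) c f = trans (cong (_+_ (c * f zero)) (∑ᶻ-*ˡ n c (f ∘ suc))) (sym (ℤₚ.*-distribˡ-+ c (f zero) (∑ n (f ∘ suc))))

  ∑ᶻ-zero : ∀ n → ∑ n (λ _ → + 0) ≡ + 0
  ∑ᶻ-zero zero    = refl
  ∑ᶻ-zero (suc n) = trans (ℤₚ.+-identityˡ _) (∑ᶻ-zero n)

  ∑ᶻ-swap : ∀ m n (f : Fin m → Fin n → ℤ) → ∑ m (λ i → ∑ n (f i)) ≡ ∑ n (λ j → ∑ m (λ i → f i j))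
  ∑ᶻ-swap zero    n f = sym (∑ᶻ-zero n)
  ∑ᶻ-swap (suc m) n f = trans (cong (_+_ (∑ n (f zero))) (∑ᶻ-swap m n (f ∘ suc)))
    (sym (∑ᶻ-distrib-+ n (f zero) (λ j → ∑ m (λ i → f (suc i) j))))

  ∑ᶻ-+ : ∀ m n (f : Fin (m ℕ.+ n) → ℤ) → ∑ (m ℕ.+ n) f ≡ ∑ m (f ∘ (_↑ˡ n)) + ∑ n (f ∘ (m ↑ʳ_))
  ∑ᶻ-+ zero    n f = sym (ℤₚ.+-identityˡ _)
  ∑ᶻ-+ (suc m) n f = trans (cong (λ s → f zero + s) (∑ᶻ-+ m n (f ∘ suc))) (sym (ℤₚ.+-assoc (f zero) _ _))

  ∑ᶻ-++ : ∀ {A B C : Set} {m n} (F : A → B → C → ℤ) (a : Vector A m) a′ (b : Vector B m) b′ (c : Vector C m) (c′ : Vector C n) →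
    ∑ (m ℕ.+ n) (λ i → F ((a ++ a′) i) ((b ++ b′) i) ((c ++ c′) i)) ≡
    ∑ m (λ i → F (a i) (b i) (c i)) + ∑ n (λ i → F (a′ i) (b′ i) (c′ i))
  ∑ᶻ-++ {m = m} {n} F a a′ b b′ c c′ = trans (∑ᶻ-+ m n _) (cong₂ _+_ (∑ᶻ-cong m left) (∑ᶻ-cong n right))
    where
    left : ∀ i → F ((a ++ a′) (i ↑ˡ n)) ((b ++ b′) (i ↑ˡ n)) ((c ++ c′) (i ↑ˡ n)) ≡ F (a i) (b i) (c i)
    left i rewrite Vectorₚ.lookup-++ˡ a a′ i | Vectorₚ.lookup-++ˡ b b′ i | Vectorₚ.lookup-++ˡ c c′ i = refl
    right : ∀ i → F ((a ++ a′) (m ↑ʳ i)) ((b ++ b′) (m ↑ʳ i)) ((c ++ c′) (m ↑ʳ i)) ≡ F (a′ i) (b′ i) (c′ i)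
    right i rewrite Vectorₚ.lookup-++ʳ a a′ i | Vectorₚ.lookup-++ʳ b b′ i | Vectorₚ.lookup-++ʳ c c′ i = refl

  ⟦_⟧ : Bool → ℤ
  ⟦ b ⟧ = if b then + 1 else + 0

  -- (1 + x)(1 + y) = 4uv for u = (1 + x)/2 and v = (1 + y)/2; the bit of x is not u because true encodes -1.
  and-gadget : ∀ u v → toℤ± (not u xor not v) + (toℤ± (not u xor false) + (toℤ± (false xor not v) + + 1)) ≡ + 4 * ⟦ u ∧ v ⟧
  and-gadget false false = refl
  and-gadget false true  = refl
  and-gadget true  false = refl
  and-gadget true  true  = refl

  dot-∑ : ∀ {M n} (w : Vec (Fin M) n) u v →
    ∑ n (λ i → + toℕ (lookup w i) * ⟦ lookup u i ∧ lookup v i ⟧) ≡ + dot w u v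
  dot-∑ []      []      []      = refl
  dot-∑ (t ∷ w) (a ∷ u) (b ∷ v) = cong₂ _+_ (gate-⟦⟧ (a ∧ b)) (dot-∑ w u v)
    where
    gate-⟦⟧ : ∀ c → + toℕ t * ⟦ c ⟧ ≡ + (if c then toℕ t else 0)
    gate-⟦⟧ false = ℤₚ.*-zeroʳ (+ toℕ t)
    gate-⟦⟧ true  = ℤₚ.*-identityʳ (+ toℕ t)

  sgn-⊖ : ∀ s θ → sgn (s ⊖ θ) ≡ (s ℕ.<ᵇ θ)
  sgn-⊖ zero    zero    = refl
  sgn-⊖ zero    (suc θ) = refl
  sgn-⊖ (suc s) zero    = refl
  sgn-⊖ (suc s) (suc θ) = trans (cong sgn (ℤₚ.[1+m]⊖[1+n]≡m⊖n s θ)) (sgn-⊖ s θ)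

  sgn-8* : ∀ z → sgn (+ 8 * z) ≡ sgn z
  sgn-8* (+ zero)  = refl
  sgn-8* (+ suc n) = refl
  sgn-8* -[1+ n ]  = refl

  -- The 1, there to keep the weighted sum of the LTF odd, cannot change the sign: a negative
  -- multiple of 8 is at most -8, and 0 already counts as positive.
  sgn-1+8* : ∀ z → sgn (+ 1 + + 8 * z) ≡ sgn z
  sgn-1+8* (+ zero)  = refl
  sgn-1+8* (+ suc n) = refl
  sgn-1+8* -[1+ n ]  rewrite ℕₚ.+-suc n (n ℕ.+ 6 ℕ.* suc n) = refl

  sgn-difference : ∀ s θ → sgn (+ s - + θ) ≡ (s ℕ.<ᵇ θ)
  sgn-difference s θ = trans (cong sgn (ℤₚ.m-n≡m⊖n s θ)) (sgn-⊖ s θ)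

  1+2*z≢0 : ∀ z → + 1 + + 2 * z ≢ + 0
  1+2*z≢0 z e = ℕₚ.even≢odd ∣ z ∣ 0 (trans (sym (ℤₚ.abs-* (+ 2) z)) (cong ∣_∣ 2z≡-1))
    where
    shift : ∀ a → a ≡ (+ 1 + a) - + 1
    shift = solve-∀
    2z≡-1 : + 2 * z ≡ -[1+ 0 ]
    2z≡-1 = trans (shift (+ 2 * z)) (cong (_- + 1) e)

  -- Thresholds as restrictions of an LTF composed with XOR.

  module XorThreshold {M n : ℕ} (e : ℕ) (w : Vec (Fin M) n) (θ : ℕ) where

    rest arity : ℕ
    rest = n ℕ.+ (n ℕ.+ (n ℕ.+ e))
    arity = suc rest

    weight : Vector ℤ n
    weight i = + toℕ (lookup w i)

    halfWeights : Vector ℤ rest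
    halfWeights = weight ++ (weight ++ (weight ++ (λ _ → + 0)))

    constantHalf : ℤ
    constantHalf = ∑ n weight - + 4 * + θ

    -- One odd weight and otherwise even ones keep the sum odd, hence nonzero, on all inputs and not
    -- just on encodings. The odd weight carries the constants: the sum of the weights supplies the
    -- 1 in each gadget, and `θ` appears fourfold because a gadget is 4uv.
    weights : Vector ℤ arity
    weights = (+ 1 + + 2 * constantHalf) Vector.∷ (λ i → + 2 * halfWeights i)

    value : Vector Bool arity → ℤ
    value x = ∑ arity (λ i → weights i * toℤ± (x i))

    value-even : ∀ x → value x ≡ (+ 1 + + 2 * constantHalf) * toℤ± (x zero) + + 2 * ∑ rest (λ i → halfWeights i * toℤ± (x (suc i)))
    value-even x = cong (_+_ ((+ 1 + + 2 * constantHalf) * toℤ± (x zero)))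
      (trans (∑ᶻ-cong rest (λ i → ℤₚ.*-assoc (+ 2) (halfWeights i) (toℤ± (x (suc i)))))
        (∑ᶻ-*ˡ rest (+ 2) (λ i → halfWeights i * toℤ± (x (suc i)))))

    value≢0 : ∀ x → value x ≢ + 0
    value≢0 x v≡0 = odd (x zero) (trans (sym (value-even x)) v≡0)
      where
      B = ∑ rest (λ i → halfWeights i * toℤ± (x (suc i)))
      plus : ∀ a b → (+ 1 + + 2 * a) * + 1 + + 2 * b ≡ + 1 + + 2 * (a + b)
      plus = solve-∀
      minus : ∀ a b → (+ 1 + + 2 * a) * -[1+ 0 ] + + 2 * b ≡ + 1 + + 2 * (b - a - + 1)
      minus = solve-∀
      odd : ∀ s → (+ 1 + + 2 * constantHalf) * toℤ± s + + 2 * B ≢ + 0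
      odd false h = 1+2*z≢0 (constantHalf + B) (trans (sym (plus constantHalf B)) h)
      odd true  h = 1+2*z≢0 (B - constantHalf - + 1) (trans (sym (minus constantHalf B)) h)

    function : Vector Bool arity → Bool
    function x = sgn (value x)

    isLTF : IsLTF arity function
    isLTF = weights , value≢0 , λ _ → refl

    plain : ∀ {m} → Vector Bool m
    plain _ = false

    negated : Vec Bool n → Vector Bool n
    negated u i = not (lookup u i)

    -- After XOR the three blocks read xy, x and y. The leading coordinate is fixed to +1, and the
    -- last `e` coordinates have weight 0 and only adjust the arity.
    encodeAlice encodeBob : Vec Bool n → Vector Bool arity
    encodeAlice u = false Vector.∷ (negated u ++ (negated u ++ (plain {n} ++ plain)))
    encodeBob v = false Vector.∷ (negated v ++ (plain {n} ++ (negated v ++ plain)))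

    value-encode : ∀ u v → value (λ i → encodeAlice u i xor encodeBob v i) ≡ + 1 + + 8 * (+ dot w u v - + θ)
    value-encode u v = begin
      value (λ i → encodeAlice u i xor encodeBob v i)
        ≡⟨ value-even (λ i → encodeAlice u i xor encodeBob v i) ⟩
      (+ 1 + + 2 * constantHalf) * + 1 + + 2 * ∑ rest (λ i → F (halfWeights i) (encodeAlice u (suc i)) (encodeBob v (suc i)))
        ≡⟨ cong (λ s → (+ 1 + + 2 * constantHalf) * + 1 + + 2 * s) (trans (∑ᶻ-++ F weight _ (negated u) _ (negated v) _)
             (cong (_+_ s₁) (trans (∑ᶻ-++ F weight _ (negated u) _ plain _)
             (cong (_+_ s₂) (trans (∑ᶻ-++ F weight (λ _ → + 0) plain plain (negated v) plain)
             (cong (_+_ s₃) (∑ᶻ-zero e))))))) ⟩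
      (+ 1 + + 2 * constantHalf) * + 1 + + 2 * (s₁ + (s₂ + (s₃ + + 0)))
        ≡⟨ regroup s₀ (+ θ) s₁ s₂ s₃ ⟩
      + 1 + (+ 2 * (s₁ + (s₂ + (s₃ + s₀))) - + 8 * + θ)
        ≡⟨ cong (λ s → + 1 + (+ 2 * s - + 8 * + θ)) gadgets ⟩
      + 1 + (+ 2 * (+ 4 * + dot w u v) - + 8 * + θ)
        ≡⟨ factor (+ dot w u v) (+ θ) ⟩
      + 1 + + 8 * (+ dot w u v - + θ) ∎
      where
      open ≡-Reasoning
      F : ℤ → Bool → Bool → ℤ
      F c a b = c * toℤ± (a xor b)
      s₀ = ∑ n weight
      s₁ = ∑ n (λ i → F (weight i) (negated u i) (negated v i))
      s₂ = ∑ n (λ i → F (weight i) (negated u i) false)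
      s₃ = ∑ n (λ i → F (weight i) false (negated v i))
      regroup : ∀ s₀ θ s₁ s₂ s₃ → (+ 1 + + 2 * (s₀ - + 4 * θ)) * + 1 + + 2 * (s₁ + (s₂ + (s₃ + + 0))) ≡
        + 1 + (+ 2 * (s₁ + (s₂ + (s₃ + s₀))) - + 8 * θ)
      regroup = solve-∀
      factor : ∀ d θ → + 1 + (+ 2 * (+ 4 * d) - + 8 * θ) ≡ + 1 + + 8 * (d - θ)
      factor = solve-∀
      distribute : ∀ c a b d → c * a + (c * b + (c * d + c)) ≡ c * (a + (b + (d + + 1)))
      distribute = solve-∀
      commute : ∀ c g → c * (+ 4 * g) ≡ + 4 * (c * g)
      commute = solve-∀
      gadgets : s₁ + (s₂ + (s₃ + s₀)) ≡ + 4 * + dot w u v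
      gadgets = begin
        s₁ + (s₂ + (s₃ + s₀))
          ≡⟨ sym (trans (∑ᶻ-distrib-+ n _ _) (cong (_+_ s₁) (trans (∑ᶻ-distrib-+ n _ _) (cong (_+_ s₂) (∑ᶻ-distrib-+ n _ _))))) ⟩
        ∑ n (λ i → F (weight i) (negated u i) (negated v i) + (F (weight i) (negated u i) false + (F (weight i) false (negated v i) + weight i)))
          ≡⟨ ∑ᶻ-cong n (λ i → trans (distribute (weight i) _ _ _) (trans (cong (weight i *_) (and-gadget (lookup u i) (lookup v i)))
               (commute (weight i) ⟦ lookup u i ∧ lookup v i ⟧))) ⟩
        ∑ n (λ i → + 4 * (weight i * ⟦ lookup u i ∧ lookup v i ⟧))
          ≡⟨ ∑ᶻ-*ˡ n (+ 4) _ ⟩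
        + 4 * ∑ n (λ i → weight i * ⟦ lookup u i ∧ lookup v i ⟧)
          ≡⟨ cong (+ 4 *_) (dot-∑ w u v) ⟩
        + 4 * + dot w u v ∎

    function-encode : ∀ u v → (function ∘XOR) (encodeAlice u) (encodeBob v) ≡ threshold w θ u v
    function-encode u v = trans (cong sgn (value-encode u v))
      (trans (sgn-1+8* (+ dot w u v - + θ)) (sgn-difference (dot w u v) θ))

  -- Binary digits, and thresholds as restrictions of GHR.

  bit : ℕ → ℕ → Bool
  bit zero    x = x ℕ.% 2 ℕ.≡ᵇ 1
  bit (suc i) x = bit i (x ℕ./ 2)

  binary-expansion : ∀ k x → x ℕ.< 2 ℕ.^ k → ∑ k (λ i → + (2 ℕ.^ toℕ i) * ⟦ bit (toℕ i) x ⟧) ≡ + x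
  binary-expansion zero    zero _ = refl
  binary-expansion zero (suc x) (ℕ.s≤s ())
  binary-expansion (suc k) x x<2^1+k = begin
    + 1 * ⟦ bit 0 x ⟧ + ∑ k (λ i → + (2 ℕ.^ suc (toℕ i)) * ⟦ bit (toℕ i) (x ℕ./ 2) ⟧)
      ≡⟨ cong₂ _+_ (lowest (x ℕ.% 2) (ℕ.m%n<n x 2)) (trans (∑ᶻ-cong k (λ i → trans
           (cong (_* ⟦ bit (toℕ i) (x ℕ./ 2) ⟧) (ℤₚ.pos-* 2 (2 ℕ.^ toℕ i))) (ℤₚ.*-assoc (+ 2) (+ (2 ℕ.^ toℕ i)) ⟦ bit (toℕ i) (x ℕ./ 2) ⟧)))
           (∑ᶻ-*ˡ k (+ 2) (λ i → + (2 ℕ.^ toℕ i) * ⟦ bit (toℕ i) (x ℕ./ 2) ⟧))) ⟩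
    + (x ℕ.% 2) + + 2 * ∑ k (λ i → + (2 ℕ.^ toℕ i) * ⟦ bit (toℕ i) (x ℕ./ 2) ⟧)
      ≡⟨ cong (λ s → + (x ℕ.% 2) + + 2 * s) (binary-expansion k (x ℕ./ 2) x/2<2^k) ⟩
    + (x ℕ.% 2) + + 2 * + (x ℕ./ 2)
      ≡⟨ cong (_+_ (+ (x ℕ.% 2))) (trans (ℤₚ.*-comm (+ 2) (+ (x ℕ./ 2))) (sym (ℤₚ.pos-* (x ℕ./ 2) 2))) ⟩
    + (x ℕ.% 2 ℕ.+ x ℕ./ 2 ℕ.* 2)
      ≡⟨ cong +_ (sym (ℕ.m≡m%n+[m/n]*n x 2)) ⟩
    + x ∎
    where
    open ≡-Reasoning
    lowest : ∀ r → r ℕ.< 2 → + 1 * ⟦ r ℕ.≡ᵇ 1 ⟧ ≡ + r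
    lowest zero          _ = refl
    lowest (suc zero)    _ = refl
    lowest (suc (suc r)) (ℕ.s≤s (ℕ.s≤s ()))
    x/2<2^k : x ℕ./ 2 ℕ.< 2 ℕ.^ k
    x/2<2^k = ℕ.m<n*o⇒m/o<n (subst (x ℕ.<_) (ℕₚ.*-comm 2 (2 ℕ.^ k)) x<2^1+k)

  Ulk-sign : ∀ z → ⌊ (z ℚ./ 1 ℚ.+ ℚ.½) ℚ.<? ℚ.0ℚ ⌋ ≡ sgn z
  Ulk-sign (+ n) = trans (isYes≗does _) (dec-false ((+ n) ℚ./ 1 ℚ.+ ℚ.½ ℚ.<? ℚ.0ℚ) (λ lt → ℚₚ.<-irrefl refl
    (ℚₚ.<-trans lt (ℚₚ.+-mono-≤-< (subst (ℚ.0ℚ ℚ.≤_) (sym (+n/1≡ιn n)) (0≤ι n)) (ℚₚ.positive⁻¹ ℚ.½)))))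
  Ulk-sign -[1+ n ] = trans (isYes≗does _) (dec-true (-[1+ n ] ℚ./ 1 ℚ.+ ℚ.½ ℚ.<? ℚ.0ℚ)
    (ℚₚ.≤-<-trans (ℚₚ.+-monoˡ-≤ ℚ.½ (ℚₚ.neg-antimono-≤ (subst (ι 1 ℚ.≤_) (sym (+n/1≡ιn (suc n))) (ι-mono (ℕ.s≤s ℕ.z≤n)))))
      (ℚₚ.negative⁻¹ (ℚ.- ι 1 ℚ.+ ℚ.½))))

  module GHRThreshold {M n : ℕ} (w : Vec (Fin M) n) (θ : ℕ)
    (M≤ : M ℕ.≤ 2 ℕ.^ suc n) (θ< : θ ℕ.< 2 ℕ.^ suc n) where

    m : ℕ
    m = suc n

    -- Each level consists of m slots of four variables, stored as four blocks of length m.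
    -- Slot 0 contributes the threshold and slot i+1 the i-th weight.
    digit : Fin m → Fin n → Bool
    digit i j = bit (toℕ i) (toℕ (lookup w j))

    -- All variables of a level share one coefficient, so a digit of a weight cannot enter as a
    -- coefficient. Alice conjoins it with her bit instead, and a digit 0 makes the slot cancel to
    -- 0.
    aliceGate : Vec Bool n → Fin m → Vector Bool m
    aliceGate u i = bit (toℕ i) θ Vector.∷ λ j → not (digit i j ∧ lookup u j)

    -- In slot 0 the last two blocks are both -1 and, with two copies of a digit of `θ`, sum to 0 or
    -- -4. In the other slots they give y and the 1 of the gadget.
    aliceConstant : Vector Bool m
    aliceConstant = true Vector.∷ λ _ → false

    bobGate : Vec Bool n → Vector Bool m
    bobGate v = false Vector.∷ λ j → not (lookup v j)

    plain : ∀ {l} → Vector Bool l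
    plain _ = false

    encodeAlice encodeBob : Vec Bool n → Fin m → Fin (4 ℕ.* m) → Bool
    -- `4 * m` unfolds to m + (m + (m + (m + 0))), hence the empty fifth block.
    encodeAlice u i = aliceGate u i ++ (aliceGate u i ++ (aliceConstant ++ (aliceConstant ++ plain)))
    encodeBob v i = bobGate v ++ (plain {m} ++ (bobGate v ++ (plain {m} ++ plain)))

    level-encode : ∀ u v i → ∑ (4 ℕ.* m) (λ j → toℤ± (encodeAlice u i j xor encodeBob v i j)) ≡
      + 4 * (∑ n (λ j → ⟦ digit i j ⟧ * ⟦ lookup u j ∧ lookup v j ⟧) - ⟦ bit (toℕ i) θ ⟧)
    level-encode u v i = begin
      ∑ (4 ℕ.* m) (λ j → toℤ± (encodeAlice u i j xor encodeBob v i j))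
        ≡⟨ trans (∑ᶻ-++ F plain plain (aliceGate u i) _ (bobGate v) _)
             (cong (_+_ s₁) (trans (∑ᶻ-++ F plain plain (aliceGate u i) _ plain _)
             (cong (_+_ s₂) (trans (∑ᶻ-++ F plain plain aliceConstant _ (bobGate v) _)
             (cong (_+_ s₃) (trans (∑ᶻ-++ F plain (plain {0}) aliceConstant plain plain plain) (ℤₚ.+-identityʳ s₄))))))) ⟩
      s₁ + (s₂ + (s₃ + s₄))
        ≡⟨ sym (trans (∑ᶻ-distrib-+ m f₁ (λ j → f₂ j + (f₃ j + f₄ j))) (cong (_+_ s₁)
             (trans (∑ᶻ-distrib-+ m f₂ (λ j → f₃ j + f₄ j)) (cong (_+_ s₂) (∑ᶻ-distrib-+ m f₃ f₄))))) ⟩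
      ∑ m (λ j → f₁ j + (f₂ j + (f₃ j + f₄ j)))
        ≡⟨ cong₂ _+_ (threshold-slot (bit (toℕ i) θ)) (∑ᶻ-cong n (λ j → weight-slot (digit i j) (lookup u j) (lookup v j))) ⟩
      + 4 * - ⟦ bit (toℕ i) θ ⟧ + ∑ n (λ j → + 4 * (⟦ digit i j ⟧ * ⟦ lookup u j ∧ lookup v j ⟧))
        ≡⟨ cong (_+_ (+ 4 * - ⟦ bit (toℕ i) θ ⟧)) (∑ᶻ-*ˡ n (+ 4) (λ j → ⟦ digit i j ⟧ * ⟦ lookup u j ∧ lookup v j ⟧)) ⟩
      + 4 * - ⟦ bit (toℕ i) θ ⟧ + + 4 * S
        ≡⟨ collect ⟦ bit (toℕ i) θ ⟧ S ⟩
      + 4 * (S - ⟦ bit (toℕ i) θ ⟧) ∎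
      where
      open ≡-Reasoning
      F : Bool → Bool → Bool → ℤ
      F _ a b = toℤ± (a xor b)
      f₁ f₂ f₃ f₄ : Fin m → ℤ
      f₁ j = toℤ± (aliceGate u i j xor bobGate v j)
      f₂ j = toℤ± (aliceGate u i j xor false)
      f₃ j = toℤ± (aliceConstant j xor bobGate v j)
      f₄ j = toℤ± (aliceConstant j xor false)
      s₁ = ∑ m f₁
      s₂ = ∑ m f₂
      s₃ = ∑ m f₃
      s₄ = ∑ m f₄
      S = ∑ n (λ j → ⟦ digit i j ⟧ * ⟦ lookup u j ∧ lookup v j ⟧)
      collect : ∀ b s → + 4 * - b + + 4 * s ≡ + 4 * (s - b)
      collect = solve-∀
      threshold-slot : ∀ b → toℤ± (b xor false) + (toℤ± (b xor false) + (-[1+ 0 ] + -[1+ 0 ])) ≡ + 4 * - ⟦ b ⟧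
      threshold-slot false = refl
      threshold-slot true  = refl
      weight-slot : ∀ d a b → toℤ± (not (d ∧ a) xor not b) + (toℤ± (not (d ∧ a) xor false) + (toℤ± (false xor not b) + + 1)) ≡
        + 4 * (⟦ d ⟧ * ⟦ a ∧ b ⟧)
      weight-slot false a b = trans (and-gadget false b) (cong (+ 4 *_) (sym (ℤₚ.*-zeroˡ ⟦ a ∧ b ⟧)))
      weight-slot true  a b = trans (and-gadget a b) (cong (+ 4 *_) (sym (ℤₚ.*-identityˡ ⟦ a ∧ b ⟧)))

    -- Summing over levels reassembles weights and threshold from their digits. The 8 is the
    -- gadget's 4 times 2, as the exponents in `Ulk` start at 1. A tie gives 0, which the ½ in `Ulk`
    -- resolves as `threshold` does.
    value-encode : ∀ u v →
      ∑ m (λ i → ∑ (4 ℕ.* m) (λ j → + (2 ℕ.^ suc (toℕ i)) * toℤ± (encodeAlice u i j xor encodeBob v i j))) ≡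
      + 8 * (+ dot w u v - + θ)
    value-encode u v = begin
      ∑ m (λ i → ∑ (4 ℕ.* m) (λ j → + (2 ℕ.^ suc (toℕ i)) * toℤ± (encodeAlice u i j xor encodeBob v i j)))
        ≡⟨ ∑ᶻ-cong m (λ i → trans (∑ᶻ-*ˡ (4 ℕ.* m) (+ (2 ℕ.^ suc (toℕ i))) (λ j → toℤ± (encodeAlice u i j xor encodeBob v i j)))
             (trans (cong₂ _*_ (ℤₚ.pos-* 2 (2 ℕ.^ toℕ i)) (level-encode u v i))
               (trans (spread (+ (2 ℕ.^ toℕ i)) (S i) ⟦ bit (toℕ i) θ ⟧)
                 (cong (λ s → + 8 * (s - + (2 ℕ.^ toℕ i) * ⟦ bit (toℕ i) θ ⟧)) (sym (∑ᶻ-*ˡ n (p i) (λ j → ⟦ digit i j ⟧ * g j))))))) ⟩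
      ∑ m (λ i → + 8 * (∑ n (λ j → p i * (⟦ digit i j ⟧ * g j)) - p i * ⟦ bit (toℕ i) θ ⟧))
        ≡⟨ ∑ᶻ-*ˡ m (+ 8) (λ i → ∑ n (λ j → p i * (⟦ digit i j ⟧ * g j)) - p i * ⟦ bit (toℕ i) θ ⟧) ⟩
      + 8 * ∑ m (λ i → ∑ n (λ j → p i * (⟦ digit i j ⟧ * g j)) - p i * ⟦ bit (toℕ i) θ ⟧)
        ≡⟨ cong (+ 8 *_) (trans (∑ᶻ-distrib-+ m (λ i → ∑ n (λ j → p i * (⟦ digit i j ⟧ * g j))) (λ i → - (p i * ⟦ bit (toℕ i) θ ⟧))) (cong₂ _+_ weights-part threshold-part)) ⟩
      + 8 * (+ dot w u v - + θ) ∎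
      where
      open ≡-Reasoning
      p : Fin m → ℤ
      p i = + (2 ℕ.^ toℕ i)
      g : Fin n → ℤ
      g j = ⟦ lookup u j ∧ lookup v j ⟧
      S : Fin m → ℤ
      S i = ∑ n (λ j → ⟦ digit i j ⟧ * g j)
      spread : ∀ p s b → (+ 2 * p) * (+ 4 * (s - b)) ≡ + 8 * (p * s - p * b)
      spread = solve-∀
      weights-part : ∑ m (λ i → ∑ n (λ j → p i * (⟦ digit i j ⟧ * g j))) ≡ + dot w u v
      weights-part = begin
        ∑ m (λ i → ∑ n (λ j → p i * (⟦ digit i j ⟧ * g j)))
          ≡⟨ ∑ᶻ-swap m n (λ i j → p i * (⟦ digit i j ⟧ * g j)) ⟩
        ∑ n (λ j → ∑ m (λ i → p i * (⟦ digit i j ⟧ * g j)))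
          ≡⟨ ∑ᶻ-cong n (λ j → trans (∑ᶻ-cong m (λ i → rotate (p i) ⟦ digit i j ⟧ (g j)))
               (trans (∑ᶻ-*ˡ m (g j) (λ i → p i * ⟦ digit i j ⟧))
                 (trans (cong (g j *_) (binary-expansion m (toℕ (lookup w j)) (ℕₚ.<-≤-trans (Finₚ.toℕ<n (lookup w j)) M≤)))
                   (ℤₚ.*-comm (g j) (+ toℕ (lookup w j)))))) ⟩
        ∑ n (λ j → + toℕ (lookup w j) * g j)
          ≡⟨ dot-∑ w u v ⟩
        + dot w u v ∎
        where
        rotate : ∀ p d g → p * (d * g) ≡ g * (p * d)
        rotate = solve-∀
      threshold-part : ∑ m (λ i → - (p i * ⟦ bit (toℕ i) θ ⟧)) ≡ - + θ
      threshold-part = trans (∑ᶻ-cong m (λ i → sym (ℤₚ.-1*i≡-i (p i * ⟦ bit (toℕ i) θ ⟧)))) (trans (∑ᶻ-*ˡ m -[1+ 0 ] (λ i → p i * ⟦ bit (toℕ i) θ ⟧))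
        (trans (cong (-[1+ 0 ] *_) (binary-expansion m θ θ<)) (ℤₚ.-1*i≡-i (+ θ))))

    GHR-encode : ∀ u v → GHR (4 ℕ.* m) m (encodeAlice u) (encodeBob v) ≡ threshold w θ u v
    GHR-encode u v = trans (Ulk-sign Z) (trans (cong sgn (value-encode u v))
      (trans (sgn-8* (+ dot w u v - + θ)) (sgn-difference (dot w u v) θ)))
      where
      Z = ∑ m (λ i → ∑ (4 ℕ.* m) (λ j → + (2 ℕ.^ suc (toℕ i)) * toℤ± (encodeAlice u i j xor encodeBob v i j)))

open Analysis using (threshold; HardThreshold; hard-threshold-PP; module Pullback)
open Encodings using (module XorThreshold; module GHRThreshold)
open import Data.Nat using (ℕ; suc; NonZero; _≤_; _<_; _+_; _*_; s≤s; z≤n)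
open import Data.Nat.Properties
open import Data.Nat.DivMod
open import Data.Nat.Tactic.RingSolver using (solve-∀)
open import Data.Bool using (Bool)
open import Data.Fin using (Fin)
open import Data.Product using (Σ; _×_; _,_)
open import Relation.Binary.PropositionalEquality

-- Covering all arities.

n≡quotient+remainder : ∀ d .{{_ : NonZero d}} n → d * (n / d) + n % d ≡ n
n≡quotient+remainder d n = trans (+-comm (d * (n / d)) (n % d))
  (trans (cong (n % d +_) (*-comm d (n / d))) (sym (m≡m%n+[m/n]*n n d)))

-- With `e` at most 2 the arity is at most 3(n + 1), and `j < d` gives n + 1 ≤ dk + d. This is the
-- shape N ≤ Dk + D for D = 3d.
blocks-≤ : ∀ d k j e → j < d → e < 3 → let n = d * k + j in suc (n + (n + (n + e))) ≤ (3 * d) * k + 3 * d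
blocks-≤ d k j e j<d e<3 = begin
  suc (n + (n + (n + e)))    ≡⟨ sym (trans (cong (λ s → n + (n + s)) (+-suc n e)) (trans (cong (n +_) (+-suc n (n + e))) (+-suc n (n + (n + e))))) ⟩
  n + (n + (n + suc e))      ≤⟨ +-monoʳ-≤ n (+-monoʳ-≤ n (+-monoʳ-≤ n e<3)) ⟩
  n + (n + (n + 3))          ≡⟨ triple n ⟩
  3 * suc n                  ≤⟨ *-monoʳ-≤ 3 (≤-trans (≤-reflexive (sym (+-suc (d * k) j))) (+-monoʳ-≤ (d * k) j<d)) ⟩
  3 * (d * k + d)            ≡⟨ trans (*-distribˡ-+ 3 (d * k) d) (cong (_+ 3 * d) (sym (*-assoc 3 d k))) ⟩
  (3 * d) * k + 3 * d        ∎
  where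
  open ≤-Reasoning
  n = d * k + j
  triple : ∀ n → n + (n + (n + 3)) ≡ 3 * suc n
  triple = solve-∀

HardLTF : (q n : ℕ) → Set
HardLTF q n = Σ ((Fin n → Bool) → Bool) λ f → IsLTF n f × PP≥ (f ∘XOR) q n

HardGHR : (q m : ℕ) → Set
HardGHR q m = PP≥ (GHR (4 * m) m) q m

hardLTF-from : ∀ {n} s D e → let N = suc (n + (n + (n + e))) in HardThreshold n s D N → HardLTF (D * (5 + s)) N
hardLTF-from s D e (M , w , θ , _ , _ , pp) = function , isLTF ,
  Pullback.PP≥-pullback encodeAlice encodeBob {threshold w θ} {function ∘XOR} {D * (5 + s)} {arity} function-encode pp
  where open XorThreshold e w θ

hardGHR-from : ∀ {n} s D → HardThreshold n s D (suc n) → HardGHR (D * (5 + s)) (suc n)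
hardGHR-from s D (M , w , θ , M≤ , θ< , pp) =
  Pullback.PP≥-pullback encodeAlice encodeBob {threshold w θ} {GHR (4 * m) m} {D * (5 + s)} {m} GHR-encode pp
  where open GHRThreshold w θ M≤ θ<

module Assembly (d s : ℕ) .{{_ : NonZero d}}
  (hard : ∀ k j D N → j < d → N ≤ D * k + D → HardThreshold (d * k + j) s D N) where

  hardLTF : ∀ n → 1 ≤ n → HardLTF ((3 * d) * (5 + s)) n
  hardLTF (suc n) _ = subst (HardLTF ((3 * d) * (5 + s))) (cong suc three)
    (hardLTF-from s (3 * d) e (subst (λ b → HardThreshold b s (3 * d) (suc (b + (b + (b + e))))) (n≡quotient+remainder d a)
      (hard k j (3 * d) (suc (b + (b + (b + e)))) j<d (blocks-≤ d k j e j<d (m%n<n n 3)))))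
    where
    -- One variable is the constant; the other n split into three blocks of length `a` and at most
    -- two of weight 0.
    a = n / 3
    e = n % 3
    k = a / d
    j = a % d
    b = d * k + j
    j<d = m%n<n a d
    three : a + (a + (a + e)) ≡ n
    three = trans (trans (sym (trans (+-assoc a (a + a) e) (cong (a +_) (+-assoc a a e)))) (cong (λ s → a + (a + s) + e) (sym (+-identityʳ a)))) (n≡quotient+remainder 3 n)

  -- The universal threshold function underlying this GHR has 4m² variables, so a bound linear in m
  -- is of the order of the square root of their number.
  hardGHR : ∀ m → 1 ≤ m → HardGHR (d * (5 + s)) m
  hardGHR (suc n) _ = hardGHR-from s d (subst (λ b → HardThreshold b s d (suc b)) (n≡quotient+remainder d n)
    (hard k j d (suc (d * k + j)) j<d (≤-trans (≤-reflexive (sym (+-suc (d * k) j))) (+-monoʳ-≤ (d * k) j<d))))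
    where
    k = n / d
    j = n % d
    j<d = m%n<n n d

mainTheorem6 : (Σ ℕ λ q → (1 ≤ q) ×
    ((n : ℕ) → 1 ≤ n → Σ ((Fin n → Bool) → Bool) λ f → IsLTF n f × PP≥ (f ∘XOR) q n))
    ×
    (Σ ℕ λ q → Σ ℕ λ m₀ → (1 ≤ q) ×
    ((m : ℕ) → m₀ ≤ m → PP≥ (GHR (4 * m) m) q m))
mainTheorem6 =
  ((3 * 1024) * (5 + 45) , s≤s z≤n , Assembly.hardLTF 1024 45 hard-threshold-PP) ,
  (1024 * (5 + 45) , 1 , s≤s z≤n , Assembly.hardGHR 1024 45 hard-threshold-PP)
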